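{- For every $n\ge1$, the Borel chromatic number of the Schreier graph of the shift action of $\mathbb{Z}^n$ on $F(2^{\mathbb{Z}^n})$ (with respect to the standard generators) equals $3$: $\chi_B(F(2^{\mathbb{Z}^n}))=3$.
   Context: $\mathbb{Z}^n$ acts on $2^{\mathbb{Z}^n}=\{0,1\}^{\mathbb{Z}^n}$ by the Bernoulli shift $(g\cdot x)(h)=x(g+h)$. The free part is $F(2^{\mathbb{Z}^n})=\{x\in2^{\mathbb{Z}^n}:\forall g\in\mathbb{Z}^n\setminus\{0\},\ g\cdot x\ne x\}$. The Schreier graph on $F(2^{\mathbb{Z}^n})$ has edges $(x,s\cdot x)$ for $s\in\{\pm e_1,\dots,\pm e_n\}$, the standard generators. The Borel chromatic number $\chi_B$ of a Borel graph is the least countable cardinal $\kappa$ for which there is a Borel map $c$ from the vertex set to $\kappa$ with $c(x)\ne c(y)$ whenever $x,y$ are adjacent. -}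

module Defs where

open import Data.Bool using (Bool)
open import Data.Fin using (Fin)
open import Data.Integer as ℤ using (ℤ; 0ℤ; 1ℤ)
open import Data.List.Relation.Unary.All using (All)
open import Data.Nat using (ℕ)
open import Data.Product using (Σ; ∃-syntax; _×_; proj₁)
open import Data.Sum using (_⊎_)
open import Data.Unit.Polymorphic using (⊤)
open import Data.Vec using (Vec; replicate; zipWith; map; _[_]≔_)
open import Function using (_↣_)
open import Level using (0ℓ; suc; Lift)
open import Relation.Binary using (Rel)
open import Relation.Binary.PropositionalEquality using (_≡_; _≢_; _≗_)
open import Relation.Nullary using (¬_)
open import Relation.Unary using (Pred; _∈_; _≐_; _⊢_; ∁; ⋃)

-- A family of subsets of X; the instances below are the open sets of a topology.
Family : Set → Set₂
Family X = Pred X 0ℓ → Set₁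

-- The σ-algebra generated by the open sets.  Constructor `resp` is there
-- because subsets with the same elements need not be propositionally equal.
data Borel {X : Set} (Open : Family X) : Pred X 0ℓ → Set₁ where
  open-set   : ∀ {A} → Open A → Borel Open A
  complement : ∀ {A} → Borel Open A → Borel Open (∁ A)
  union      : ∀ {A : ℕ → Pred X 0ℓ} → (∀ k → Borel Open (A k)) → Borel Open (⋃ ℕ A)
  resp       : ∀ {A B} → A ≐ B → Borel Open A → Borel Open B

BorelMap : {X Y : Set} → Family X → Family Y → (X → Y) → Set₁
BorelMap OpenX OpenY f = ∀ {A} → Borel OpenY A → Borel OpenX (f ⊢ A)

DiscreteOpen : {X : Set} → Family X
DiscreteOpen _ = ⊤

SubspaceOpen : {X : Set} → Family X → (P : Pred X 0ℓ) → Family (Σ X P)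
SubspaceOpen Open P V = ∃[ U ] Open U × V ≐ (proj₁ ⊢ U)

-- Every countable cardinal is finite or ℵ₀; _≤ᶜ_ is the usual order on cardinals.
data CountableCardinal : Set where
  fin : ℕ → CountableCardinal
  ℵ₀  : CountableCardinal

⟦_⟧ : CountableCardinal → Set
⟦ fin k ⟧ = Fin k
⟦ ℵ₀ ⟧    = ℕ

_≤ᶜ_ : Rel CountableCardinal 0ℓ
κ ≤ᶜ κ′ = ⟦ κ ⟧ ↣ ⟦ κ′ ⟧

BorelColoring : {X : Set} → Family X → Rel X 0ℓ → CountableCardinal → Set₁
BorelColoring {X} Open _~_ κ =
  Σ (X → ⟦ κ ⟧) λ c →
    BorelMap Open DiscreteOpen c × (∀ {x y} → x ~ y → c x ≢ c y)

IsBorelChromaticNumber : {X : Set} → Family X → Rel X 0ℓ → CountableCardinal → Set₁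
IsBorelChromaticNumber Open _~_ κ =
  BorelColoring Open _~_ κ × (∀ κ′ → BorelColoring Open _~_ κ′ → κ ≤ᶜ κ′)

-- Vectors rather than functions Fin n → ℤ, so that ≡ on ℤ^ n is the intended
-- equality without function extensionality.
ℤ^ : ℕ → Set
ℤ^ n = Vec ℤ n

𝟎 : ∀ {n} → ℤ^ n
𝟎 {n} = replicate n 0ℤ

_⊕_ : ∀ {n} → ℤ^ n → ℤ^ n → ℤ^ n
_⊕_ = zipWith ℤ._+_

e : ∀ {n} → Fin n → ℤ^ n
e i = 𝟎 [ i ]≔ 1ℤ

IsGenerator : ∀ {n} → Pred (ℤ^ n) 0ℓ
IsGenerator s = ∃[ i ] (s ≡ e i ⊎ s ≡ map ℤ.-_ (e i))

-- 2^(ℤ^ n); its points are compared by pointwise equality _≗_.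
Config : ℕ → Set
Config n = ℤ^ n → Bool

_∙_ : ∀ {n} → ℤ^ n → Config n → Config n
(g ∙ x) h = x (g ⊕ h)

-- The product topology: around each of its points, an open set contains a
-- cylinder fixing finitely many coordinates.
ProductOpen : ∀ {n} → Family (Config n)
ProductOpen {n} U =
  Lift (suc 0ℓ)
  (∀ x → x ∈ U → ∃[ hs ] (∀ y → All (λ h → y h ≡ x h) hs → y ∈ U))

Free : ∀ {n} → Pred (Config n) 0ℓ
Free x = ∀ g → g ≢ 𝟎 → ¬ (g ∙ x ≗ x)

F : ℕ → Set
F n = Σ (Config n) Free

FOpen : ∀ {n} → Family (F n)
FOpen = SubspaceOpen ProductOpen Free

Schreier : ∀ {n} → Rel (F n) 0ℓ
Schreier x y = ∃[ s ] IsGenerator s × proj₁ y ≗ s ∙ proj₁ x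

{-# OPTIONS --safe #-}
-- Upper bound.  At every scale k, finitely many layers (their number bounded
-- independently of k, by packing) of widely separated Borel sets of centers come
-- within a fixed distance of all points.  On each orbit some index i occurs at
-- infinitely many scales; using only the layers with the least such i, and
-- letting balls absorb the smaller pieces they come close to, yields a Borel
-- toast: finite pieces covering the orbit, any two of which are either far
-- apart or nested with a margin.  Colouring each point by parity inside
-- the smallest piece containing it fails only across the boundary of a piece
-- whose parity disagrees with that of its surroundings; there the third colour,
-- used in a collar of width 2, swaps the two parity classes.
--
-- Lower bound.  In a Borel 2-colouring each colour class A would alternate along
-- e₀.  By Baire category A contains or misses, up to a meager set, some
-- cylinder; a generic point lying in that cylinder together with its translate
-- by an odd multiple of e₀ contradicts the alternation.
module Submission where

open import Axiom.ExcludedMiddle using (ExcludedMiddle)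
open import Data.Bool using (Bool; true; false; not; if_then_else_)
open import Data.Bool.Properties using (not-involutive; not-¬; ¬-not; not-injective) renaming (_≟_ to _≟ᵇ_)
open import Data.Empty using (⊥; ⊥-elim)
open import Data.Fin as Fin using (Fin; toℕ)
import Data.Fin.Properties as Fin
open import Data.Integer as ℤ using (ℤ; +_; -[1+_]; 0ℤ; 1ℤ; ∣_∣)
import Data.Integer.Properties as ℤ
import Data.Integer.Solver as ℤ
open import Data.List as List using (List; []; _∷_)
open import Data.List.Membership.Propositional renaming (_∈_ to _∈ˡ_)
import Data.List.Membership.Propositional.Properties as List
import Data.List.Relation.Unary.All as All
import Data.List.Relation.Unary.All.Properties as All
open import Data.List.Relation.Unary.All using (All; []; _∷_)
open import Data.List.Relation.Unary.Any using (here; there)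
open import Data.Nat hiding (parity)
open import Data.Nat.DivMod using (m≡m%n+[m/n]*n; m%n<n; m<n*o⇒m/o<n)
open import Data.Nat.Properties
open import Data.Nat.Solver using (module +-*-Solver)
open import Data.Product
open import Data.Sum as Sum using (_⊎_; inj₁; inj₂; [_,_]′)
open import Data.Unit using (⊤; tt)
open import Data.Vec as Vec using (Vec; []; _∷_)
import Data.Vec.Properties as Vec
open import Function using (_∘_; id; _↠_; mk↠ₛ; mk↣; module Surjection)
open import Level using (0ℓ; lift)
open import Relation.Binary using (tri<; tri≈; tri>)
open import Relation.Binary.PropositionalEquality hiding (resp)
open import Relation.Nullary using (¬_; Dec; yes; no)
open import Relation.Nullary.Decidable using (decidable-stable; does; dec-true; dec-false)
open import Relation.Unary using (Pred; ∁; ⋃; _⊆_)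
open import Defs

-- The group ℤⁿ and its supremum metric

private
  variable
    n : ℕ
    A B I : Set

neg : ℤ^ n → ℤ^ n
neg = Vec.map (ℤ.-_)

⊕-assoc : (g h k : ℤ^ n) → (g ⊕ h) ⊕ k ≡ g ⊕ (h ⊕ k)
⊕-assoc = Vec.zipWith-assoc ℤ.+-assoc

⊕-comm : (g h : ℤ^ n) → g ⊕ h ≡ h ⊕ g
⊕-comm = Vec.zipWith-comm ℤ.+-comm

⊕-identityˡ : (g : ℤ^ n) → 𝟎 ⊕ g ≡ g
⊕-identityˡ = Vec.zipWith-identityˡ ℤ.+-identityˡ

⊕-identityʳ : (g : ℤ^ n) → g ⊕ 𝟎 ≡ g
⊕-identityʳ = Vec.zipWith-identityʳ ℤ.+-identityʳ

⊕-inverseˡ : (g : ℤ^ n) → neg g ⊕ g ≡ 𝟎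
⊕-inverseˡ = Vec.zipWith-inverseˡ ℤ.+-inverseˡ

⊕-inverseʳ : (g : ℤ^ n) → g ⊕ neg g ≡ 𝟎
⊕-inverseʳ = Vec.zipWith-inverseʳ ℤ.+-inverseʳ

neg-⊕-cancel : (g h : ℤ^ n) → neg g ⊕ (g ⊕ h) ≡ h
neg-⊕-cancel g h = begin
  neg g ⊕ (g ⊕ h) ≡⟨ ⊕-assoc (neg g) g h ⟨
  (neg g ⊕ g) ⊕ h ≡⟨ cong (_⊕ h) (⊕-inverseˡ g) ⟩
  𝟎 ⊕ h           ≡⟨ ⊕-identityˡ h ⟩
  h               ∎
  where open ≡-Reasoning

⊕-neg-cancel : (g h : ℤ^ n) → g ⊕ (neg g ⊕ h) ≡ h
⊕-neg-cancel g h = begin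
  g ⊕ (neg g ⊕ h) ≡⟨ ⊕-assoc g (neg g) h ⟨
  (g ⊕ neg g) ⊕ h ≡⟨ cong (_⊕ h) (⊕-inverseʳ g) ⟩
  𝟎 ⊕ h           ≡⟨ ⊕-identityˡ h ⟩
  h               ∎
  where open ≡-Reasoning

neg-involutive : (g : ℤ^ n) → neg (neg g) ≡ g
neg-involutive []      = refl
neg-involutive (a ∷ g) = cong₂ _∷_ (ℤ.neg-involutive a) (neg-involutive g)

⊕-identityʳ-unique : (g h : ℤ^ n) → g ⊕ h ≡ h → g ≡ 𝟎
⊕-identityʳ-unique g h eq = begin
  g                 ≡⟨ ⊕-neg-cancel h g ⟨
  h ⊕ (neg h ⊕ g)   ≡⟨ cong (h ⊕_) (⊕-comm (neg h) g) ⟩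
  h ⊕ (g ⊕ neg h)   ≡⟨ ⊕-assoc h g (neg h) ⟨
  (h ⊕ g) ⊕ neg h   ≡⟨ cong (_⊕ neg h) (trans (⊕-comm h g) eq) ⟩
  h ⊕ neg h         ≡⟨ ⊕-inverseʳ h ⟩
  𝟎                 ∎
  where open ≡-Reasoning

dist : ℤ^ n → ℤ^ n → ℕ
dist []      []      = 0
dist (a ∷ g) (b ∷ h) = ∣ a ℤ.- b ∣ ⊔ dist g h

‖_‖ : ℤ^ n → ℕ
‖ g ‖ = dist g 𝟎

dist-refl : (g : ℤ^ n) → dist g g ≡ 0
dist-refl []      = refl
dist-refl (a ∷ g) = cong₂ _⊔_ (cong ∣_∣ (ℤ.+-inverseʳ a)) (dist-refl g)

dist-sym : (g h : ℤ^ n) → dist g h ≡ dist h g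
dist-sym []      []      = refl
dist-sym (a ∷ g) (b ∷ h) = cong₂ _⊔_ (ℤ.∣i-j∣≡∣j-i∣ a b) (dist-sym g h)

dist-triangle : (g h k : ℤ^ n) → dist g k ≤ dist g h + dist h k
dist-triangle []      []      []      = z≤n
dist-triangle (a ∷ g) (b ∷ h) (c ∷ k) = ⊔-lub
  (begin
    ∣ a ℤ.- c ∣                   ≡⟨ cong ∣_∣ (a-c a b c) ⟩
    ∣ (a ℤ.- b) ℤ.+ (b ℤ.- c) ∣   ≤⟨ ℤ.∣i+j∣≤∣i∣+∣j∣ (a ℤ.- b) (b ℤ.- c) ⟩
    ∣ a ℤ.- b ∣ + ∣ b ℤ.- c ∣     ≤⟨ +-mono-≤ (m≤m⊔n ∣ a ℤ.- b ∣ _) (m≤m⊔n ∣ b ℤ.- c ∣ _) ⟩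
    dist (a ∷ g) (b ∷ h) + dist (b ∷ h) (c ∷ k) ∎)
  (≤-trans (dist-triangle g h k) (+-mono-≤ (m≤n⊔m ∣ a ℤ.- b ∣ _) (m≤n⊔m ∣ b ℤ.- c ∣ _)))
  where
  open ≤-Reasoning
  open ℤ.+-*-Solver
  a-c : ∀ a b c → a ℤ.- c ≡ (a ℤ.- b) ℤ.+ (b ℤ.- c)
  a-c = solve 3 (λ a b c → a :- c := (a :- b) :+ (b :- c)) refl

dist-⊕ˡ : (t g h : ℤ^ n) → dist (t ⊕ g) (t ⊕ h) ≡ dist g h
dist-⊕ˡ []      []      []      = refl
dist-⊕ˡ (c ∷ t) (a ∷ g) (b ∷ h) = cong₂ _⊔_ (cong ∣_∣ (shift c a b)) (dist-⊕ˡ t g h)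
  where
  open ℤ.+-*-Solver
  shift : ∀ c a b → (c ℤ.+ a) ℤ.- (c ℤ.+ b) ≡ a ℤ.- b
  shift = solve 3 (λ c a b → (c :+ a) :- (c :+ b) := a :- b) refl

dist-step : ∀ {r s} (g h k : ℤ^ n) → dist g h ≤ r → dist h k ≤ s → dist g k ≤ r + s
dist-step g h k g~h h~k = ≤-trans (dist-triangle g h k) (+-mono-≤ g~h h~k)

dist-swap : ∀ {r} (g h : ℤ^ n) → dist g h ≤ r → dist h g ≤ r
dist-swap g h = subst (_≤ _) (dist-sym g h)

-- Links the metric inside one orbit with the norms in `Near` and `Separated`: `neg g ⊕ h` is the
-- element that carries `g · x` to `h · x`.
‖neg⊕‖ : (g h : ℤ^ n) → ‖ neg g ⊕ h ‖ ≡ dist h g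
‖neg⊕‖ g h = begin
  dist (neg g ⊕ h) 𝟎           ≡⟨ cong (dist (neg g ⊕ h)) (⊕-inverseˡ g) ⟨
  dist (neg g ⊕ h) (neg g ⊕ g) ≡⟨ dist-⊕ˡ (neg g) h g ⟩
  dist h g                     ∎
  where open ≡-Reasoning

‖neg‖ : (g : ℤ^ n) → ‖ neg g ‖ ≡ ‖ g ‖
‖neg‖ g = begin
  dist (neg g) 𝟎      ≡⟨ cong (λ h → dist h 𝟎) (⊕-identityʳ (neg g)) ⟨
  dist (neg g ⊕ 𝟎) 𝟎  ≡⟨ ‖neg⊕‖ g 𝟎 ⟩
  dist 𝟎 g            ≡⟨ dist-sym 𝟎 g ⟩
  dist g 𝟎            ∎
  where open ≡-Reasoning

dist-⊕ : (g h : ℤ^ n) → dist (g ⊕ h) h ≡ ‖ g ‖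
dist-⊕ g h = begin
  dist (g ⊕ h) h       ≡⟨ cong₂ dist (⊕-comm g h) (sym (⊕-identityʳ h)) ⟩
  dist (h ⊕ g) (h ⊕ 𝟎) ≡⟨ dist-⊕ˡ h g 𝟎 ⟩
  dist g 𝟎             ∎
  where open ≡-Reasoning

‖⊕‖ : (g h : ℤ^ n) → ‖ g ⊕ h ‖ ≤ ‖ g ‖ + ‖ h ‖
‖⊕‖ g h = subst (λ r → ‖ g ⊕ h ‖ ≤ r + ‖ h ‖) (dist-⊕ g h) (dist-triangle (g ⊕ h) h 𝟎)

-- Parity, the 2-colouring of the Cayley graph of ℤⁿ

odd : ℕ → Bool
odd zero    = false
odd (suc m) = not (odd m)

parity : ℤ^ n → Bool
parity []      = false
parity (a ∷ g) = if odd ∣ a ∣ then not (parity g) else parity g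

odd-1+ : ∀ a → odd ∣ 1ℤ ℤ.+ a ∣ ≡ not (odd ∣ a ∣)
odd-1+ (+ m)          = refl
odd-1+ -[1+ zero ]    = refl
odd-1+ -[1+ suc m ]   = sym (not-involutive _)

Flips : ℤ^ n → Set
Flips t = ∀ g → parity (t ⊕ g) ≡ not (parity g)

flips-neg : (t : ℤ^ n) → Flips t → Flips (neg t)
flips-neg t flips g = begin
  parity (neg t ⊕ g)             ≡⟨ not-involutive _ ⟨
  not (not (parity (neg t ⊕ g))) ≡⟨ cong not (flips (neg t ⊕ g)) ⟨
  not (parity (t ⊕ (neg t ⊕ g))) ≡⟨ cong (not ∘ parity) (⊕-neg-cancel t g) ⟩
  not (parity g)                 ∎
  where open ≡-Reasoning

private
  if-not : ∀ b c → (if not b then not c else c) ≡ not (if b then not c else c)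
  if-not true  c = sym (not-involutive c)
  if-not false c = refl

  not-if : ∀ b c → (if b then not (not c) else not c) ≡ not (if b then not c else c)
  not-if true  c = refl
  not-if false c = refl

  e-flips : (i : Fin n) → Flips (e i)
  e-flips Fin.zero    (a ∷ g) rewrite odd-1+ a | ⊕-identityˡ g = if-not (odd ∣ a ∣) (parity g)
  e-flips (Fin.suc i) (a ∷ g) rewrite ℤ.+-identityˡ a | e-flips i g = not-if (odd ∣ a ∣) (parity g)


  ‖e‖ : (i : Fin n) → ‖ e i ‖ ≤ 1
  ‖e‖ {suc n} Fin.zero    = ⊔-lub ≤-refl (≤-trans (≤-reflexive (dist-refl (𝟎 {n}))) z≤n)
  ‖e‖ (Fin.suc i) = ‖e‖ i

generator-flips : {s : ℤ^ n} → IsGenerator s → Flips s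
generator-flips (i , inj₁ refl) = e-flips i
generator-flips (i , inj₂ refl) = flips-neg (e i) (e-flips i)

generator-short : {s : ℤ^ n} → IsGenerator s → ‖ s ‖ ≤ 1
generator-short (i , inj₁ refl) = ‖e‖ i
generator-short (i , inj₂ refl) = subst (_≤ 1) (sym (‖neg‖ (e i))) (‖e‖ i)

-- Countable sets

antidiagonal : ℕ → ℕ × ℕ
antidiagonal zero    = 0 , 0
antidiagonal (suc k) with antidiagonal k
... | zero  , b = suc b , 0
... | suc a , b = a , suc b

antidiagonal-surjective : ∀ a b → ∃ λ k → antidiagonal k ≡ (a , b)
antidiagonal-surjective a b = go (a + b) a b refl
  where
  -- Follows the enumeration backwards: either the second coordinate drops along an antidiagonal, or
  -- the sum drops.
  go : ∀ s a b → a + b ≡ s → ∃ λ k → antidiagonal k ≡ (a , b)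
  go _       zero    zero    _    = 0 , refl
  go (suc s) (suc a) zero    eq with go s zero a (trans (sym (+-identityʳ a)) (suc-injective eq))
  ... | k , eq′ = suc k , lem
    where
    lem : antidiagonal (suc k) ≡ (suc a , 0)
    lem rewrite eq′ = refl
  go s       a       (suc b) eq with go s (suc a) b (trans (sym (+-suc a b)) eq)
  ... | k , eq′ = suc k , lem
    where
    lem : antidiagonal (suc k) ≡ (a , suc b)
    lem rewrite eq′ = refl

Countable : Set → Set
Countable A = ℕ ↠ A

enumerate : Countable A → ℕ → A
enumerate = Surjection.to

index : (c : Countable A) (a : A) → ∃ λ k → enumerate c k ≡ a
index c = Surjection.strictlySurjective c

countable-image : Countable A → (f : A → B) → (∀ b → ∃ λ a → f a ≡ b) → Countable B
countable-image cA f surj = mk↠ₛ {to = f ∘ enumerate cA} λ b →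
  let a , fa≡b = surj b
      k , k≡a  = index cA a
  in k , trans (cong f k≡a) fa≡b

ℕ-countable : Countable ℕ
ℕ-countable = mk↠ₛ {to = id} λ k → k , refl

Bool-countable : Countable Bool
Bool-countable = countable-image ℕ-countable odd λ { false → 0 , refl ; true → 1 , refl }

ℕ×ℕ-countable : Countable (ℕ × ℕ)
ℕ×ℕ-countable = mk↠ₛ {to = antidiagonal} λ (a , b) → antidiagonal-surjective a b

×-countable : Countable A → Countable B → Countable (A × B)
×-countable cA cB = countable-image ℕ×ℕ-countable (map (enumerate cA) (enumerate cB)) λ (a , b) →
  let k , k≡a = index cA a
      l , l≡b = index cB b
  in (k , l) , cong₂ _,_ k≡a l≡b

ℤ-countable : Countable ℤ
ℤ-countable = countable-image ℕ×ℕ-countable (uncurry ℤ._⊖_)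
  λ { (+ m) → (m , 0) , refl ; -[1+ m ] → (0 , suc m) , refl }

Vec-countable : Countable A → ∀ n → Countable (Vec A n)
Vec-countable cA zero    = mk↠ₛ {to = λ _ → []} λ { [] → 0 , refl }
Vec-countable cA (suc n) = countable-image (×-countable cA (Vec-countable cA n)) (uncurry _∷_)
  λ { (a ∷ as) → (a , as) , refl }

List-countable : Countable A → Countable (List A)
List-countable cA = countable-image ℕ×ℕ-countable
  (λ (n , k) → Vec.toList (enumerate (Vec-countable cA n) k)) λ as →
  let k , eq = index (Vec-countable cA (List.length as)) (Vec.fromList as)
  in (List.length as , k) , trans (cong Vec.toList eq) (Vec.toList∘fromList as)

ℤ^-countable : Countable (ℤ^ n)
ℤ^-countable = Vec-countable ℤ-countable _

-- The shift action on the free part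

infix 4 _≈_

_≈_ : F n → F n → Set
x ≈ y = proj₁ x ≗ proj₁ y

abstract
  -- By commutativity an element fixing `g ∙ x` fixes `x`, as evaluation at `neg g ⊕ k` shows.
  ∙-free : ∀ g {x : Config n} → Free x → Free (g ∙ x)
  ∙-free g {x} free h h≢𝟎 fixed = free h h≢𝟎 λ k → begin
      x (h ⊕ k)                   ≡⟨ cong x (regroup h k) ⟩
      x (g ⊕ (h ⊕ (neg g ⊕ k)))   ≡⟨ fixed (neg g ⊕ k) ⟩
      x (g ⊕ (neg g ⊕ k))         ≡⟨ cong x (⊕-neg-cancel g k) ⟩
      x k                         ∎
    where
    open ≡-Reasoning
    regroup : ∀ h k → h ⊕ k ≡ g ⊕ (h ⊕ (neg g ⊕ k))
    regroup h k = begin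
      h ⊕ k                   ≡⟨ cong (h ⊕_) (⊕-neg-cancel g k) ⟨
      h ⊕ (g ⊕ (neg g ⊕ k))   ≡⟨ ⊕-assoc h g _ ⟨
      (h ⊕ g) ⊕ (neg g ⊕ k)   ≡⟨ cong (_⊕ (neg g ⊕ k)) (⊕-comm h g) ⟩
      (g ⊕ h) ⊕ (neg g ⊕ k)   ≡⟨ ⊕-assoc g h _ ⟩
      g ⊕ (h ⊕ (neg g ⊕ k))   ∎

infixr 6 _·_

_·_ : ℤ^ n → F n → F n
g · (x , free) = g ∙ x , ∙-free g free

·-⊕ : (g h : ℤ^ n) (x : F n) → (g ⊕ h) · x ≈ h · g · x
·-⊕ g h (x , _) k = cong x (⊕-assoc g h k)

·-𝟎 : (x : F n) → 𝟎 · x ≈ x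
·-𝟎 (x , _) k = cong x (⊕-identityˡ k)

-- Borel subsets of the free part

ℬ : Pred (F n) 0ℓ → Set₁
ℬ = Borel FOpen

-- Pointwise equal configurations need not be propositionally equal. Borel sets cannot separate
-- them, since every open set around a point contains a cylinder; this stands in for extensionality
-- below.
ℬ-resp-≈ : {A : Pred (F n) 0ℓ} → ℬ A → ∀ x y → x ≈ y → A x → A y
ℬ-resp-≈ (open-set (U , lift isOpen , A⊆U , U⊆A)) x y x≈y x∈A =
  U⊆A (proj₂ (isOpen (proj₁ x) (A⊆U x∈A)) (proj₁ y) (All.universal (λ h → sym (x≈y h)) _))
ℬ-resp-≈ (complement b)         x y x≈y x∉A       = x∉A ∘ ℬ-resp-≈ b y x (sym ∘ x≈y)
ℬ-resp-≈ (union bs)             x y x≈y (k , x∈A) = k , ℬ-resp-≈ (bs k) x y x≈y x∈A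
ℬ-resp-≈ (resp (A⊆B , B⊆A) b)   x y x≈y x∈B       = A⊆B (ℬ-resp-≈ b x y x≈y (B⊆A x∈B))

ℬ-const : (P : Set) → ℬ {n} (λ _ → P)
ℬ-const P = open-set ((λ _ → P) , lift (λ _ p → [] , λ _ _ → p) , id , id)

ℬ-∃ : Countable I → {A : I → Pred (F n) 0ℓ} → (∀ i → ℬ (A i)) → ℬ (λ x → ∃ λ i → A i x)
ℬ-∃ c {A} b = resp
  ( (λ (k , a) → enumerate c k , a)
  , (λ {x} (i , a) → let k , eq = index c i in k , subst (λ i → A i x) (sym eq) a))
  (union (b ∘ enumerate c))

ℬ-⊎ : {A B : Pred (F n) 0ℓ} → ℬ A → ℬ B → ℬ (λ x → A x ⊎ B x)
ℬ-⊎ {A = A} {B} a b = resp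
  ( (λ { (true , x∈A) → inj₁ x∈A ; (false , x∈B) → inj₂ x∈B })
  , [ true ,_ , false ,_ ]′)
  (ℬ-∃ Bool-countable {λ c → if c then A else B} λ { true → a ; false → b })

ℬ-shift : (g : ℤ^ n) {A : Pred (F n) 0ℓ} → ℬ A → ℬ (λ x → A (g · x))
ℬ-shift g (open-set (U , lift isOpen , A⊆U , U⊆A)) = open-set
  ( (λ x → U (g ∙ x))
  , lift (λ x x∈U → let hs , cylinder = isOpen (g ∙ x) x∈U in
      List.map (g ⊕_) hs , λ y agree → cylinder (g ∙ y) (All.map⁻ agree))
  , A⊆U , U⊆A)
ℬ-shift g (complement b)       = complement (ℬ-shift g b)
ℬ-shift g (union bs)           = union (λ k → ℬ-shift g (bs k))
ℬ-shift g (resp (A⊆B , B⊆A) b) = resp (A⊆B , B⊆A) (ℬ-shift g b)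

-- Packing

private
  offset : ∀ r a → ∣ a ∣ ≤ r → + ∣ a ℤ.+ + r ∣ ≡ a ℤ.+ + r
  offset r (+ m)    _   = refl
  offset r -[1+ m ] m<r rewrite ℤ.⊖-≥ m<r = refl

  quotient-close : ∀ L a b → a / suc L ≡ b / suc L → ∣ + a ℤ.- + b ∣ ≤ L
  quotient-close L a b eq = begin
    ∣ + a ℤ.- + b ∣                   ≡⟨ cong ∣_∣ (ℤ.m-n≡m⊖n a b) ⟩
    ∣ a ℤ.⊖ b ∣                       ≡⟨ cong₂ (λ a b → ∣ a ℤ.⊖ b ∣) (m≡m%n+[m/n]*n a (suc L)) (m≡m%n+[m/n]*n b (suc L)) ⟩
    ∣ (a % suc L + a / suc L * suc L) ℤ.⊖ (b % suc L + b / suc L * suc L) ∣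
      ≡⟨ cong (λ q → ∣ (a % suc L + a / suc L * suc L) ℤ.⊖ (b % suc L + q * suc L) ∣) eq ⟨
    ∣ (a % suc L + a / suc L * suc L) ℤ.⊖ (b % suc L + a / suc L * suc L) ∣
      ≡⟨ cong₂ (λ a b → ∣ a ℤ.⊖ b ∣) (+-comm (a % suc L) _) (+-comm (b % suc L) _) ⟩
    ∣ (a / suc L * suc L + a % suc L) ℤ.⊖ (a / suc L * suc L + b % suc L) ∣
      ≡⟨ cong ∣_∣ (ℤ.+-cancelˡ-⊖ (a / suc L * suc L) _ _) ⟩
    ∣ a % suc L ℤ.⊖ b % suc L ∣       ≤⟨ ℤ.∣m⊝n∣≤m⊔n (a % suc L) _ ⟩
    a % suc L ⊔ b % suc L             ≤⟨ ⊔-lub (s≤s⁻¹ (m%n<n a (suc L))) (s≤s⁻¹ (m%n<n b (suc L))) ⟩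
    L                                 ∎
    where open ≤-Reasoning

  digit-bound : ∀ L a → ∣ a ∣ ≤ 5 * L → ∣ a ℤ.+ + (5 * L) ∣ / suc L < 10
  digit-bound L a short = m<n*o⇒m/o<n (begin-strict
    ∣ a ℤ.+ + (5 * L) ∣   ≤⟨ ℤ.∣i+j∣≤∣i∣+∣j∣ a (+ (5 * L)) ⟩
    ∣ a ∣ + 5 * L         ≤⟨ +-monoˡ-≤ (5 * L) short ⟩
    5 * L + 5 * L         ≡⟨ *-distribʳ-+ L 5 5 ⟨
    10 * L                <⟨ *-monoʳ-< 10 (n<1+n L) ⟩
    10 * suc L            ∎)
    where open ≤-Reasoning

  digit-close : ∀ L a b → ∣ a ∣ ≤ 5 * L → ∣ b ∣ ≤ 5 * L →
                ∣ a ℤ.+ + (5 * L) ∣ / suc L ≡ ∣ b ℤ.+ + (5 * L) ∣ / suc L → ∣ a ℤ.- b ∣ ≤ L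
  digit-close L a b a-short b-short eq = subst (λ c → ∣ c ∣ ≤ L)
    (trans (cong₂ ℤ._-_ (offset (5 * L) a a-short) (offset (5 * L) b b-short)) (lem a b (+ (5 * L))))
    (quotient-close L (∣ a ℤ.+ + (5 * L) ∣) (∣ b ℤ.+ + (5 * L) ∣) eq)
    where
    open ℤ.+-*-Solver
    lem : ∀ a b r → (a ℤ.+ r) ℤ.- (b ℤ.+ r) ≡ a ℤ.- b
    lem = solve 3 (λ a b r → (a :+ r) :- (b :+ r) := a :- b) refl

  head-short : ∀ {r} a (g : ℤ^ n) → ‖ a ∷ g ‖ ≤ r → ∣ a ∣ ≤ r
  head-short a g short = subst (λ b → ∣ b ∣ ≤ _) (ℤ.+-identityʳ a) (≤-trans (m≤m⊔n _ _) short)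

  tail-short : ∀ {r} a (g : ℤ^ n) → ‖ a ∷ g ‖ ≤ r → ‖ g ‖ ≤ r
  tail-short a g short = ≤-trans (m≤n⊔m ∣ a ℤ.- 0ℤ ∣ _) short

-- Cuts the ball of radius `5 * L` into `10 ^ n` boxes. Each coordinate, shifted into the interval
-- from 0 to `10 * L`, has at most ten quotients by `suc L`, and equal quotients force a difference
-- of at most `L`.
cell : ∀ L (g : ℤ^ n) → ‖ g ‖ ≤ 5 * L → Fin (10 ^ n)
cell L []      _     = Fin.zero
cell L (a ∷ g) short = Fin.combine (Fin.fromℕ< (digit-bound L a (head-short a g short)))
  (cell L g (tail-short a g short))

cell-close : ∀ L (g h : ℤ^ n) g-short h-short → cell L g g-short ≡ cell L h h-short → dist g h ≤ L
cell-close L []      []      _       _       _  = z≤n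
cell-close L (a ∷ g) (b ∷ h) g-short h-short eq
  with Fin.combine-injective _ (cell L g (tail-short a g g-short)) _ (cell L h (tail-short b h h-short)) eq
... | digits , cells = ⊔-lub
  (digit-close L a b (head-short a g g-short) (head-short b h h-short) (Fin.fromℕ<-injective _ _ _ _ digits))
  (cell-close L g h (tail-short a g g-short) (tail-short b h h-short) cells)

-- Scales

-- slack k bounds the growth of a set while it absorbs pieces of levels below k.
-- That cover k exceeds mesh k by k makes up for any fixed additive constant,
-- as soon as k is large.
slack : ℕ → ℕ

mesh cover extent capture : ℕ → ℕ
mesh    k = 2 + k + slack k
cover   k = mesh k + k
extent  k = cover k + slack k
capture k = slack k + (2 + extent k)

slack zero    = 0
slack (suc k) = capture k + (extent k + 3 + slack k)

-- The left side bounds the distance of the centers of two level-`k` pieces that come within 2 of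
-- each other, so separation identifies these centers.
extent-sum : ∀ k → extent k + (2 + extent k) ≤ 5 * mesh k
extent-sum k = subst (extent k + (2 + extent k) ≤_) (lem k (slack k)) (m≤m+n _ (k + slack k + 4))
  where
  open +-*-Solver
  lem : ∀ k s → (2 + k + s + k + s) + (2 + (2 + k + s + k + s)) + (k + s + 4) ≡ 5 * (2 + k + s)
  lem = solve 2 (λ k s → let r = con 2 :+ k :+ s :+ k :+ s in
    r :+ (con 2 :+ r) :+ (k :+ s :+ con 4) := con 5 :* (con 2 :+ k :+ s)) refl

-- The same for a level-`k` piece within 2 of a point that grew, by at most `slack k`, out of an
-- absorbed level-`k` ball. As `extent k` contains `slack k` twice, `slack k` occurs five times,
-- which accounts for the factor 5.
extent-slack-sum : ∀ k → extent k + (2 + (slack k + (extent k + 3))) ≤ 5 * mesh k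
extent-slack-sum k = subst (extent k + (2 + (slack k + (extent k + 3))) ≤_) (lem k (slack k)) (m≤m+n _ (k + 1))
  where
  open +-*-Solver
  lem : ∀ k s → (2 + k + s + k + s) + (2 + (s + ((2 + k + s + k + s) + 3))) + (k + 1) ≡ 5 * (2 + k + s)
  lem = solve 2 (λ k s → let r = con 2 :+ k :+ s :+ k :+ s in
    r :+ (con 2 :+ (s :+ (r :+ con 3))) :+ (k :+ con 1) := con 5 :* (con 2 :+ k :+ s)) refl

-- Toasts

Centers : ℕ → Set₁
Centers n = ℕ → Pred (ℤ^ n) 0ℓ

-- The added ball contains the whole level-`j` piece around `m` with a margin of 3.
absorb : Centers n → ℕ → Pred (ℤ^ n) 0ℓ → Pred (ℤ^ n) 0ℓ
absorb N j Q g =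
  Q g ⊎ (∃ λ m → N j m × (∃ λ q → Q q × dist q m ≤ capture j) × dist m g ≤ extent j + 3)

-- Levels are absorbed from the top down, so what is added after level `j` reaches no further than
-- `slack j`.
hull : Centers n → ℕ → Pred (ℤ^ n) 0ℓ → Pred (ℤ^ n) 0ℓ
hull N zero    Q = Q
hull N (suc j) Q = hull N j (absorb N j Q)

Ball : ℕ → ℤ^ n → Pred (ℤ^ n) 0ℓ
Ball r m g = dist m g ≤ r

Piece : Centers n → ℕ → ℤ^ n → Pred (ℤ^ n) 0ℓ
Piece N k m g = N k m × hull N k (Ball (cover k) m) g

hull-⊇ : ∀ (N : Centers n) k {Q} → Q ⊆ hull N k Q
hull-⊇ N zero    q = q
hull-⊇ N (suc k) q = hull-⊇ N k (inj₁ q)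

hull-bounded : ∀ (N : Centers n) k {Q g} → hull N k Q g → ∃ λ q → Q q × dist q g ≤ slack k
hull-bounded N zero {g = g} q = g , q , ≤-reflexive (dist-refl g)
hull-bounded N (suc k) {g = g} hl with hull-bounded N k hl
... | q , inj₁ q∈Q , q~g = q , q∈Q ,
  ≤-trans q~g (≤-trans (m≤n+m _ (extent k + 3)) (m≤n+m _ (capture k)))
... | p , inj₂ (m , _ , (q , q∈Q , q~m) , m~p) , p~g = q , q∈Q ,
  dist-step q m g q~m (dist-step m p g m~p p~g)

piece-bounded : ∀ (N : Centers n) k {m g} → Piece N k m g → dist m g ≤ extent k
piece-bounded N k {m} {g} (_ , hl) =
  let q , m~q , q~g = hull-bounded N k hl in dist-step m q g m~q q~g

hull-map : ∀ (N N′ : Centers n) (f : ℤ^ n → ℤ^ n) → (∀ g h → dist (f g) (f h) ≡ dist g h) →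
           (∀ j m → N j m → N′ j (f m)) → ∀ k {Q Q′} → (∀ g → Q g → Q′ (f g)) →
           ∀ {g} → hull N k Q g → hull N′ k Q′ (f g)
hull-map N N′ f isometry centers zero    q⇒q′ q  = q⇒q′ _ q
hull-map N N′ f isometry centers (suc k) {Q} {Q′} q⇒q′ hl = hull-map N N′ f isometry centers k step hl
  where
  step : ∀ g → absorb N k Q g → absorb N′ k Q′ (f g)
  step g (inj₁ q) = inj₁ (q⇒q′ g q)
  step g (inj₂ (m , center , (q , q∈Q , q~m) , m~g)) = inj₂
    ( f m , centers k m center , (f q , q⇒q′ q q∈Q , subst (_≤ _) (sym (isometry q m)) q~m)
    , subst (_≤ _) (sym (isometry m g)) m~g)

piece-shift : ∀ (N N′ : Centers n) (t : ℤ^ n) → (∀ j m → N j m → N′ j (t ⊕ m)) →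
              ∀ k m {g} → Piece N k m g → Piece N′ k (t ⊕ m) (t ⊕ g)
piece-shift N N′ t centers k m (center , hl) = centers k m center ,
  hull-map N N′ (t ⊕_) (dist-⊕ˡ t) centers k (λ g → subst (_≤ _) (sym (dist-⊕ˡ t m g))) hl

module Toast (N : Centers n)
  (separated : ∀ k m m′ → N k m → N k m′ → dist m m′ ≤ 5 * mesh k → m ≡ m′) where

  piece-unique : ∀ k {m m′ g g′} → Piece N k m g → Piece N k m′ g′ → dist g g′ ≤ 2 → m ≡ m′
  piece-unique k {m} {m′} {g} {g′} p@(center , _) p′@(center′ , _) g~g′ =
    separated k m m′ center center′ (≤-trans
      (dist-step m g m′ (piece-bounded N k p)
        (dist-step g g′ m′ g~g′ (dist-swap m′ g′ (piece-bounded N k p′))))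
      (extent-sum k))

  -- The capture radius exceeds the extent by the total growth that lower
  -- levels can still contribute, so a piece that is not captured stays away.
  piece-captured : ∀ {j} k {m Q g g′} → j < k → Piece N j m g → hull N k Q g′ → dist g g′ ≤ 2 →
                   ∀ {h h′} → Piece N j m h → dist h h′ ≤ 3 → hull N k Q h′
  piece-captured (suc k) {m} {Q} {g} {g′} j<k p hl g~g′ {h} {h′} ph h~h′ with m≤n⇒m<n∨m≡n (s≤s⁻¹ j<k)
  ... | inj₁ j<k  = piece-captured k j<k p hl g~g′ ph h~h′
  ... | inj₂ refl with hull-bounded N k hl
  ...   | q , inj₁ q∈Q , q~g′ = hull-⊇ N k (inj₂
          ( m , proj₁ p
          , (q , q∈Q , dist-step q g′ m q~g′
              (dist-step g′ g m (dist-swap g g′ g~g′) (dist-swap m g (piece-bounded N k p))))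
          , dist-step m h h′ (piece-bounded N k ph) h~h′))
  -- Here the nearby point stems from an absorbed ball of the same level; separation makes its
  -- center equal to `m`, so `m` itself was absorbed.
  ...   | q , inj₂ (m′ , center′ , near , m′~q) , q~g′ = hull-⊇ N k (inj₂
          ( m , proj₁ p , subst (λ m → ∃ λ q → Q q × dist q m ≤ capture k) (sym m≡m′) near
          , dist-step m h h′ (piece-bounded N k ph) h~h′))
    where
    m≡m′ : m ≡ m′
    m≡m′ = separated k m m′ (proj₁ p) center′ (≤-trans
      (dist-step m g m′ (piece-bounded N k p) (dist-step g g′ m′ g~g′
        (dist-step g′ q m′ (dist-swap q g′ q~g′) (dist-swap m′ q m′~q))))
      (extent-slack-sum k))

-- Colours

-- Minimality is a negated conjunction rather than an implication, so that it is visibly the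
-- complement of a Borel condition.
Home : Centers n → ℕ → ℤ^ n → Pred (ℤ^ n) 0ℓ
Home N k m g = Piece N k m g × (∀ j → ¬ (j < k × (∃ λ m′ → Piece N j m′ g)))

Odd : Centers n → Pred (ℤ^ n) 0ℓ
Odd N g = ∃ λ k → ∃ λ m → Home N k m g × parity m ≢ parity g

Clash : Centers n → ℕ → Pred (ℤ^ n) 0ℓ
Clash N r g = ∃ λ k → ∃ λ m → Home N k m g × (∃ λ j → ∃ λ m′ → ∃ λ h →
  j < k × Piece N j m′ h × dist g h ≤ r × parity m ≢ parity m′)

-- In terms of the parity relative to the center of a smaller piece D, points of
-- parity (even , odd) are coloured (0 , 1) in D and, if the surrounding piece
-- disagrees with D, (2 , 1) at distance 1, (2 , 0) at distance 2, (1 , 0) beyond.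
palette : (odd clash₂ clash₁ : Bool) → Fin 3
palette true  true  _     = Fin.suc (Fin.suc Fin.zero)
palette true  false _     = Fin.suc Fin.zero
palette false _     true  = Fin.suc Fin.zero
palette false _     false = Fin.zero

-- The graph of the colouring in terms of propositions instead of decided booleans, so that colours
-- can be compared by cases and moved along translations.
data Shade (N : Centers n) (g : ℤ^ n) : Fin 3 → Set where
  odd-clash     : Odd N g   → Clash N 2 g   → Shade N g (Fin.suc (Fin.suc Fin.zero))
  odd-no-clash  : Odd N g   → ¬ Clash N 2 g → Shade N g (Fin.suc Fin.zero)
  even-clash    : ¬ Odd N g → Clash N 1 g   → Shade N g (Fin.suc Fin.zero)
  even-no-clash : ¬ Odd N g → ¬ Clash N 1 g → Shade N g Fin.zero

module Shades (N : Centers n)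
  (separated : ∀ k m m′ → N k m → N k m′ → dist m m′ ≤ 5 * mesh k → m ≡ m′)
  where
  open Toast N separated

  home-unique : ∀ {k k′ m m′ g} → Home N k m g → Home N k′ m′ g → (k , m) ≡ (k′ , m′)
  home-unique {k} {k′} {m} {m′} {g} (p , min) (p′ , min′) with <-cmp k k′
  ... | tri< k<k′ _ _ = ⊥-elim (min′ k (k<k′ , m , p))
  ... | tri> _ _ k′<k = ⊥-elim (min k′ (k′<k , m′ , p′))
  ... | tri≈ _ refl _ = cong (k ,_) (piece-unique k p p′ (≤-trans (≤-reflexive (dist-refl g)) z≤n))

  Odd⇒ : ∀ {k m g} → Home N k m g → Odd N g → parity m ≡ not (parity g)
  Odd⇒ home (k , m , home′ , m≢g) with home-unique home home′
  ... | refl = ¬-not m≢g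

  ¬Odd⇒ : ∀ {k m g} → Home N k m g → ¬ Odd N g → parity m ≡ parity g
  ¬Odd⇒ {k} {m} {g} home even = decidable-stable (parity m ≟ᵇ parity g)
    λ m≢g → even (k , m , home , m≢g)

  Clash⇒ : ∀ {k m g r} → Home N k m g → Clash N r g → ∃ λ j → ∃ λ m′ → ∃ λ h →
           j < k × Piece N j m′ h × dist g h ≤ r × parity m ≢ parity m′
  Clash⇒ home (_ , _ , home′ , clash) with home-unique home home′
  ... | refl = clash

  Clash-mono : ∀ {g r s} → r ≤ s → Clash N r g → Clash N s g
  Clash-mono r≤s (k , m , home , j , m′ , h , j<k , p , g~h , m≢m′) =
    k , m , home , j , m′ , h , j<k , p , ≤-trans g~h r≤s , m≢m′

  Clash-step : ∀ {k m g g′} → dist g g′ ≤ 1 → Home N k m g → Home N k m g′ → Clash N 1 g′ → Clash N 2 g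
  Clash-step {g = g} {g′} g~g′ home home′ clash with Clash⇒ home′ clash
  ... | j , m₁ , h , j<k , p , g′~h , m≢m₁ =
    _ , _ , home , j , m₁ , h , j<k , p , dist-step g g′ h g~g′ g′~h , m≢m₁

  module _ {g g′ : ℤ^ n} (g~g′ : dist g g′ ≤ 1) (flip : parity g′ ≡ not (parity g)) where

    -- Inside one piece neighbours have opposite relative parity. The only colour shared by both
    -- parities is 1, and there a clash within 1 of one point is a clash within 2 of its neighbour:
    -- hence the two radii.
    same-home : ∀ {k m i} → Home N k m g → Home N k m g′ → Shade N g i → Shade N g′ i → ⊥
    same-home {m = m} home home′ = λ
      { (odd-clash o _)      (odd-clash o′ _)      → both-odd o o′
      ; (odd-no-clash o _)   (odd-no-clash o′ _)   → both-odd o o′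
      ; (odd-no-clash _ ¬c)  (even-clash _ c)      → ¬c (Clash-step g~g′ home home′ c)
      ; (even-clash _ c)     (odd-no-clash _ ¬c)   → ¬c (Clash-step g′~g home′ home c)
      ; (even-clash ¬o _)    (even-clash ¬o′ _)    → both-even ¬o ¬o′
      ; (even-no-clash ¬o _) (even-no-clash ¬o′ _) → both-even ¬o ¬o′
      }
      where
      g′~g : dist g′ g ≤ 1
      g′~g = dist-swap g g′ g~g′
      both-odd : Odd N g → Odd N g′ → ⊥
      both-odd o o′ = not-¬ (trans (sym (Odd⇒ home′ o′)) (Odd⇒ home o)) (cong not flip)
      both-even : ¬ Odd N g → ¬ Odd N g′ → ⊥
      both-even ¬o ¬o′ = not-¬ (trans (sym (¬Odd⇒ home′ ¬o′)) (¬Odd⇒ home ¬o)) flip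

    module _ {k k′ m m′} (home : Home N k m g) (home′ : Home N k′ m′ g′) (k<k′ : k < k′) where

      -- A smaller piece within 2 of `g` would be captured by the home of `g` together with
      -- everything within 3 of it. That includes `g′`, whose home has a higher level.
      no-clash : ¬ Clash N 2 g
      no-clash clash with Clash⇒ home clash
      ... | j , m₁ , h , j<k , p , g~h , _ = proj₂ home′ k (k<k′ , m , proj₁ (proj₁ home) ,
        piece-captured k j<k p (proj₂ (proj₁ home)) (dist-swap g h g~h) p
          (dist-step h g g′ (dist-swap g h g~h) g~g′))

      -- The clashing piece must be the home of `g`. At a lower level it would be captured by that
      -- home, at a higher one it would capture that home, and either way `g′` would lie in a piece
      -- below its own home; at the same level the centers agree.
      clash⇒disagree : Clash N 1 g′ → parity m′ ≢ parity m
      clash⇒disagree clash with Clash⇒ home′ clash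
      ... | j , m₁ , h , j<k′ , p , g′~h , m′≢m₁ with <-cmp j k
      ...   | tri< j<k _ _ = ⊥-elim (proj₂ home′ k (k<k′ , m , proj₁ (proj₁ home) ,
        piece-captured k j<k p (proj₂ (proj₁ home)) (dist-swap g h (dist-step g g′ h g~g′ g′~h)) p
          (≤-trans (dist-swap g′ h g′~h) (s≤s z≤n))))
      ...   | tri≈ _ refl _ = subst (λ m → parity m′ ≢ parity m)
        (sym (piece-unique k (proj₁ home) p (dist-step g g′ h g~g′ g′~h))) m′≢m₁
      ...   | tri> _ _ k<j = ⊥-elim (proj₂ home′ j (j<k′ , m₁ , proj₁ p ,
        piece-captured j k<j (proj₁ home) (proj₂ p) (dist-step g g′ h g~g′ g′~h) (proj₁ home)
          (≤-trans g~g′ (s≤s z≤n))))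

      disagree⇒clash : parity m′ ≢ parity m → Clash N 1 g′
      disagree⇒clash m′≢m = k′ , m′ , home′ , k , m , g , k<k′ , proj₁ home , dist-swap g g′ g~g′ , m′≢m

      -- The inner point never clashes, and the outer one clashes within 1 exactly when the two
      -- centers disagree in parity; each remaining coincidence of colours contradicts this.
      nested-home : ∀ {i} → Shade N g i → Shade N g′ i → ⊥
      nested-home (odd-clash _ c)      _                     = no-clash c
      nested-home (even-clash _ c)     _                     = no-clash (Clash-mono (s≤s z≤n) c)
      nested-home (odd-no-clash o _)   (odd-no-clash o′ ¬c′) = ¬c′ (Clash-mono (s≤s z≤n) (disagree⇒clash λ eq →
        not-¬ (trans (sym (Odd⇒ home′ o′)) (trans eq (Odd⇒ home o))) (cong not flip)))
      nested-home (odd-no-clash o _)   (even-clash ¬o′ c′)   =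
        clash⇒disagree c′ (trans (¬Odd⇒ home′ ¬o′) (trans flip (sym (Odd⇒ home o))))
      nested-home (even-no-clash ¬o _) (even-no-clash ¬o′ ¬c′) = ¬c′ (disagree⇒clash λ eq →
        not-¬ (trans (sym (¬Odd⇒ home′ ¬o′)) (trans eq (¬Odd⇒ home ¬o))) flip)

  module _ (homes : ∀ g → ∃ λ k → ∃ λ m → Home N k m g) where

    shades-differ : ∀ {g g′ i i′} → dist g g′ ≤ 1 → parity g′ ≡ not (parity g) →
                    Shade N g i → Shade N g′ i′ → i ≢ i′
    shades-differ {g} {g′} g~g′ flip s s′ refl with homes g | homes g′
    ... | k , m , home | k′ , m′ , home′ with <-cmp k k′
    ...   | tri< k<k′ _ _ = nested-home g~g′ flip home home′ k<k′ s s′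
    ...   | tri> _ _ k′<k = nested-home (dist-swap g g′ g~g′) (sym (trans (cong not flip) (not-involutive _))) home′ home k′<k s′ s
    ...   | tri≈ _ refl _ with piece-unique k (proj₁ home) (proj₁ home′) (≤-trans g~g′ (s≤s z≤n))
    ...     | refl = same-home g~g′ flip home home′ s s′


-- Translation invariance of the shades

module _ {N N′ : Centers n} (t : ℤ^ n) (flips : Flips t)
  (to : ∀ j m → N j m → N′ j (t ⊕ m)) (from : ∀ j m → N′ j m → N j (neg t ⊕ m)) where

  home-shift : ∀ {k m g} → Home N k m g → Home N′ k (t ⊕ m) (t ⊕ g)
  home-shift {k} {m} {g} (p , min) = piece-shift N N′ t to k m p , λ j (j<k , m′ , p′) → min j
    (j<k , neg t ⊕ m′ , subst (Piece N j _) (neg-⊕-cancel t g) (piece-shift N′ N (neg t) from j m′ p′))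

  parity-shift : ∀ {g h} → parity g ≢ parity h → parity (t ⊕ g) ≢ parity (t ⊕ h)
  parity-shift {g} {h} g≢h eq = g≢h (not-injective (trans (sym (flips g)) (trans eq (flips h))))

  odd-shift : ∀ {g} → Odd N g → Odd N′ (t ⊕ g)
  odd-shift (k , m , home , m≢g) = k , t ⊕ m , home-shift home , parity-shift m≢g

  clash-shift : ∀ {r g} → Clash N r g → Clash N′ r (t ⊕ g)
  clash-shift {r} {g} (k , m , home , j , m′ , h , j<k , p , g~h , m≢m′) =
    k , t ⊕ m , home-shift home , j , t ⊕ m′ , t ⊕ h , j<k , piece-shift N N′ t to j m′ p ,
    subst (_≤ r) (sym (dist-⊕ˡ t g h)) g~h , parity-shift m≢m′

module _ {N N′ : Centers n} (t : ℤ^ n) (flips : Flips t)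
  (to : ∀ j m → N j m → N′ j (t ⊕ m)) (from : ∀ j m → N′ j m → N j (neg t ⊕ m)) where

  private
    to′ : ∀ j m → N j m → N′ j (neg (neg t) ⊕ m)
    to′ j m = subst (λ t → N′ j (t ⊕ m)) (sym (neg-involutive t)) ∘ to j m

    odd-unshift : ∀ {g} → Odd N′ (t ⊕ g) → Odd N g
    odd-unshift {g} = subst (Odd N) (neg-⊕-cancel t g) ∘ odd-shift (neg t) (flips-neg t flips) from to′

    clash-unshift : ∀ {r g} → Clash N′ r (t ⊕ g) → Clash N r g
    clash-unshift {r} {g} = subst (Clash N r) (neg-⊕-cancel t g) ∘ clash-shift (neg t) (flips-neg t flips) from to′

  -- Only comparisons of parities enter a shade, so flipping all of them changes nothing. The
  -- negative conditions use the opposite translation.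
  shade-shift : ∀ {g i} → Shade N g i → Shade N′ (t ⊕ g) i
  shade-shift (odd-clash o c)       = odd-clash (odd-shift t flips to from o) (clash-shift t flips to from c)
  shade-shift (odd-no-clash o ¬c)   = odd-no-clash (odd-shift t flips to from o) (¬c ∘ clash-unshift)
  shade-shift (even-clash ¬o c)     = even-clash (¬o ∘ odd-unshift) (clash-shift t flips to from c)
  shade-shift (even-no-clash ¬o ¬c) = even-no-clash (¬o ∘ odd-unshift) (¬c ∘ clash-unshift)

-- Baire category

Agree : ℕ → Config n → Config n → Set
Agree r x y = ∀ h → ‖ h ‖ ≤ r → x h ≡ y h

agree-trans : ∀ {r} {x y z : Config n} → Agree r x y → Agree r y z → Agree r x z
agree-trans xy yz h short = trans (xy h short) (yz h short)

agree-≤ : ∀ {r s} {x y : Config n} → r ≤ s → Agree s x y → Agree r x y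
agree-≤ r≤s xy h short = xy h (≤-trans short r≤s)

agree-list : (hs : List (ℤ^ n)) → ∃ λ r → ∀ {x y} → Agree r x y → All (λ h → y h ≡ x h) hs
agree-list []       = 0 , λ _ → []
agree-list (h ∷ hs) =
  let r , agree = agree-list hs
  in ‖ h ‖ ⊔ r , λ xy → sym (xy h (m≤m⊔n _ _)) ∷ agree (agree-≤ (m≤n⊔m ‖ h ‖ r) xy)

IsOpen Dense : Pred (Config n) 0ℓ → Set
IsOpen U = ∀ x → U x → ∃ λ r → ∀ y → Agree r x y → U y
Dense  U = ∀ x r → ∃ λ y → Agree r x y × U y

Comeager : Pred (Config n) 0ℓ → Set₁
Comeager {n} G = Σ (ℕ → Pred (Config n) 0ℓ) λ U →
  (∀ k → IsOpen (U k)) × (∀ k → Dense (U k)) × (∀ x → (∀ k → U k x) → G x)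

module _ {G : Pred (Config n) 0ℓ} (G-comeager : Comeager G) (x₀ : Config n) (r₀ : ℕ) where

  private
    isOpen = proj₁ (proj₂ G-comeager)
    dense  = proj₁ (proj₂ (proj₂ G-comeager))
    ⊆G     = proj₂ (proj₂ (proj₂ G-comeager))

    approximation : ℕ → Config n × ℕ
    approximation zero    = x₀ , r₀
    approximation (suc k) =
      let x , r      = approximation k
          y , _ , yU = dense k x r
      -- The maximum keeps the next ball inside `U k`; the successor makes the radii unbounded.
      in y , suc (r ⊔ proj₁ (isOpen k y yU))

    point : ℕ → Config n
    point = proj₁ ∘ approximation

    radius : ℕ → ℕ
    radius = proj₂ ∘ approximation

    next : ∀ k → Agree (radius k) (point k) (point (suc k))
    next k = proj₁ (proj₂ (dense k (point k) (radius k)))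

    radius-step : ∀ k → suc (radius k) ≤ radius (suc k)
    radius-step k = s≤s (m≤m⊔n (radius k) _)

    radius-large : ∀ k → k ≤ radius k
    radius-large zero    = z≤n
    radius-large (suc k) = ≤-trans (s≤s (radius-large k)) (radius-step k)

    later : ∀ {k l} → k ≤′ l → radius k ≤ radius l × Agree (radius k) (point k) (point l)
    later ≤′-refl             = ≤-refl , λ _ _ → refl
    later {k} (≤′-step {l} k≤l) =
      let r≤ , agree = later k≤l
      in ≤-trans r≤ (≤-trans (n≤1+n _) (radius-step l)) , agree-trans agree (agree-≤ r≤ (next l))

    limit : Config n
    -- Coordinate `h` is settled from stage `‖ h ‖` on, because `k ≤ radius k`.
    limit h = point ‖ h ‖ h

    limit-agree : ∀ k → Agree (radius k) (point k) limit
    limit-agree k h short with ≤-total k ‖ h ‖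
    ... | inj₁ k≤h = proj₂ (later (≤⇒≤′ k≤h)) h short
    ... | inj₂ h≤k = sym (proj₂ (later (≤⇒≤′ h≤k)) h (radius-large ‖ h ‖))

  baire : ∃ λ y → Agree r₀ x₀ y × G y
  baire = limit , limit-agree 0 , ⊆G limit λ k →
    let _ , _ , yU = dense k (point k) (radius k)
        r , ball   = isOpen k (point (suc k)) yU
    in ball limit (agree-≤ (≤-trans (m≤n⊔m (radius k) r) (n≤1+n _)) (limit-agree (suc k)))

comeager-open-dense : {U : Pred (Config n) 0ℓ} → IsOpen U → Dense U → Comeager U
comeager-open-dense {U = U} isOpen dense = (λ _ → U) , (λ _ → isOpen) , (λ _ → dense) , λ x x∈U → x∈U 0

comeager-⋂ : Countable I → {G : I → Pred (Config n) 0ℓ} → (∀ i → Comeager (G i)) →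
             Comeager (λ x → ∀ i → G i x)
comeager-⋂ {n = n} c {G} comeager =
  (λ k → let i , j = antidiagonal k in U i j) ,
  (λ k → let i , j = antidiagonal k in proj₁ (proj₂ (comeager (enumerate c i))) j) ,
  (λ k → let i , j = antidiagonal k in proj₁ (proj₂ (proj₂ (comeager (enumerate c i)))) j) ,
  λ x x∈ i → let k , eq = index c i in subst (λ i → G i x) eq
    (proj₂ (proj₂ (proj₂ (comeager (enumerate c k)))) x λ j →
      let l , eq′ = antidiagonal-surjective k j in subst (λ (k , j) → U k j x) eq′ (x∈ l))
  where
  U : ℕ → ℕ → Pred (Config n) 0ℓ
  U i = proj₁ (comeager (enumerate c i))

comeager-∩ : {G H : Pred (Config n) 0ℓ} → Comeager G → Comeager H → Comeager (λ x → G x × H x)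
comeager-∩ {G = G} {H} g h =
  map₂ (map₂ (map₂ λ ⊆GH x x∈ → ⊆GH x x∈ true , ⊆GH x x∈ false))
    (comeager-⋂ Bool-countable {λ c → if c then G else H} λ { true → g ; false → h })

shift-short : ∀ (t : ℤ^ n) {r} h → ‖ h ‖ ≤ r → ‖ t ⊕ h ‖ ≤ ‖ t ‖ + r
shift-short t h short = ≤-trans (‖⊕‖ t h) (+-monoʳ-≤ ‖ t ‖ short)

comeager-shift : ∀ (t : ℤ^ n) {G} → Comeager G → Comeager (λ x → G (t ∙ x))
comeager-shift {n} t (U , isOpen , dense , ⊆G) =
  (λ k x → U k (t ∙ x)) ,
  (λ k x x∈ → let r , ball = isOpen k (t ∙ x) x∈ in
    ‖ t ‖ + r , λ y agree → ball (t ∙ y) λ h short → agree (t ⊕ h) (shift-short t h short)) ,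
  shifted-dense ,
  λ x x∈ → ⊆G (t ∙ x) x∈
  where
  shifted-dense : ∀ k → Dense (λ x → U k (t ∙ x))
  shifted-dense k x r =
    let y , agree , y∈ = dense k (t ∙ x) (‖ t ‖ + r)
        s , ball       = isOpen k y y∈
    in neg t ∙ y ,
       (λ h short → trans (cong x (sym (⊕-neg-cancel t h)))
         (agree (neg t ⊕ h) (subst (λ s → ‖ neg t ⊕ h ‖ ≤ s + r) (‖neg‖ t) (shift-short (neg t) h short)))) ,
       ball (t ∙ (neg t ∙ y)) λ h _ → cong y (sym (neg-⊕-cancel t h))

abstract
  _≟ᵛ_ : (g h : ℤ^ n) → Dec (g ≡ h)
  _≟ᵛ_ = Vec.≡-dec ℤ._≟_

-- The first multiple of `e Fin.zero` outside the ball of radius `r`; for `r + r` it is an odd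
-- multiple.
far : ℕ → ℤ^ (suc n)
far r = + suc r ∷ 𝟎

far-far : ∀ r → r < ‖ far {n} r ‖
far-far {n} r = ≤-trans (≤-reflexive (sym (+-identityʳ (suc r)))) (m≤m⊔n (suc r + 0) ‖ 𝟎 {n} ‖)

-- One open condition for each of the countably many `g`; it is dense because a coordinate outside
-- any given ball can be altered.
free-comeager : Comeager (Free {suc n})
free-comeager {n} = map₂ (map₂ (map₂ λ ⊆Moved x x∈ g g≢𝟎 fixed →
    [ g≢𝟎 , (λ (h , moved) → moved (fixed h)) ]′ (⊆Moved x x∈ g)))
  (comeager-⋂ ℤ^-countable {Moved} λ g → comeager-open-dense (moved-open g) (moved-dense g))
  where
  Moved : ℤ^ (suc n) → Pred (Config (suc n)) 0ℓ
  Moved g x = g ≡ 𝟎 ⊎ ∃ λ h → x (g ⊕ h) ≢ x h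
  moved-open : ∀ g → IsOpen (Moved g)
  moved-open g x (inj₁ g≡𝟎)         = 0 , λ _ _ → inj₁ g≡𝟎
  moved-open g x (inj₂ (h , moved)) = ‖ g ⊕ h ‖ ⊔ ‖ h ‖ , λ y agree → inj₂ (h , λ eq → moved
    (trans (agree (g ⊕ h) (m≤m⊔n _ _)) (trans eq (sym (agree h (m≤n⊔m ‖ g ⊕ h ‖ _))))))
  moved-dense : ∀ g → Dense (Moved g)
  moved-dense g x r with g ≟ᵛ 𝟎
  ... | yes g≡𝟎 = x , (λ _ _ → refl) , inj₁ g≡𝟎
  ... | no g≢𝟎  = y , agree , inj₂ (far r , moved)
    where
    y : Config (suc n)
    -- Only the coordinate `far r` changes. As `g` is nonzero, `g ⊕ far r` keeps its value, and the
    -- new value at `far r` is its opposite.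
    y h = if does (h ≟ᵛ far r) then not (x (g ⊕ far r)) else x h
    y-elsewhere : ∀ {h} → h ≢ far r → y h ≡ x h
    y-elsewhere {h} h≢far = cong (λ b → if b then not (x (g ⊕ far r)) else x h) (dec-false (h ≟ᵛ far r) h≢far)
    agree : Agree r x y
    agree h short = sym (y-elsewhere λ { refl → <⇒≱ (far-far {n} r) short })
    moved : y (g ⊕ far r) ≢ y (far r)
    moved eq = not-¬ refl (begin
      x (g ⊕ far r)         ≡⟨ y-elsewhere (λ fixed → g≢𝟎 (⊕-identityʳ-unique g (far r) fixed)) ⟨
      y (g ⊕ far r)         ≡⟨ eq ⟩
      y (far r)             ≡⟨ cong (λ b → if b then not (x (g ⊕ far r)) else x (far r)) (dec-true (far r ≟ᵛ far r) refl) ⟩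
      not (x (g ⊕ far r))   ∎)
      where open ≡-Reasoning

‖‖≤-list : (r : ℕ) → ∃ λ (gs : List (ℤ^ n)) → ∀ g → ‖ g ‖ ≤ r → g ∈ˡ gs
‖‖≤-list {zero}  r = [] ∷ [] , λ { [] _ → here refl }
‖‖≤-list {suc n} r with ‖‖≤-list {n} r
... | gs , complete = List.cartesianProductWith _∷_ as gs , λ { (a ∷ g) short →
    List.∈-cartesianProductWith⁺ _∷_
      (a∈as a (subst (λ b → ∣ b ∣ ≤ r) (ℤ.+-identityʳ a) (≤-trans (m≤m⊔n _ _) short)))
      (complete g (≤-trans (m≤n⊔m ∣ a ℤ.- 0ℤ ∣ _) short)) }
  where
  as : List ℤ
  as = List.applyUpTo +_ (suc r) List.++ List.applyUpTo -[1+_] r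
  a∈as : ∀ a → ∣ a ∣ ≤ r → a ∈ˡ as
  a∈as (+ m)    m≤r = List.∈-++⁺ˡ (List.∈-applyUpTo⁺ +_ (s≤s m≤r))
  a∈as -[1+ m ] m<r = List.∈-++⁺ʳ (List.applyUpTo +_ (suc r)) (List.∈-applyUpTo⁺ -[1+_] m<r)

-- Separated sets

Near : ℕ → Pred (F n) 0ℓ → Pred (F n) 0ℓ
Near r A x = ∃ λ g → ‖ g ‖ ≤ r × A (g · x)

Separated : ℕ → Pred (F n) 0ℓ → Set
Separated r A = ∀ x g → A x → A (g · x) → ‖ g ‖ ≤ r → g ≡ 𝟎

Code : ℕ → Set
Code n = List (ℤ^ n × Bool)

Cylinder : Code n → Pred (F n) 0ℓ
Cylinder c (x , _) = All (λ (h , b) → x h ≡ b) c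

-- These are independent sets of the graph joining orbit points at distance at most `r`; countably
-- many of them cover the free part, the usual source of a Borel maximal independent set.
SeparatedCylinder : ℕ → Code n → Pred (F n) 0ℓ
SeparatedCylinder r c x = Cylinder c x × (∀ g → ¬ (‖ g ‖ ≤ r × g ≢ 𝟎 × Cylinder c (g · x)))

Code-countable : Countable (Code n)
Code-countable = List-countable (×-countable ℤ^-countable Bool-countable)

-- Each stage adds all admissible points of one separated cylinder at once. No points are picked
-- individually, so the stages stay Borel.
greedy : ℕ → Pred (F n) 0ℓ → ℕ → Pred (F n) 0ℓ
greedy r Y zero    x = ⊥
greedy r Y (suc k) x =
  greedy r Y k x ⊎
  Y x × SeparatedCylinder r (enumerate Code-countable k) x × ¬ Near r (greedy r Y k) x

Maximal : ℕ → Pred (F n) 0ℓ → Pred (F n) 0ℓ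
Maximal r Y x = ∃ λ k → greedy r Y k x

maximal-⊆ : ∀ r {Y : Pred (F n) 0ℓ} → Maximal r Y ⊆ Y
maximal-⊆ r {Y} (k , gr) = go k gr
  where
  go : ∀ k {x} → greedy r Y k x → Y x
  go (suc k) (inj₁ old)       = go k old
  go (suc k) (inj₂ (y , _ , _)) = y

greedy-mono : ∀ r {Y : Pred (F n) 0ℓ} {k l} → k ≤ l → greedy r Y k ⊆ greedy r Y l
greedy-mono r k≤l gr = go (≤⇒≤′ k≤l) gr
  where
  go : ∀ {Y k l} → k ≤′ l → greedy r Y k ⊆ greedy r Y l
  go ≤′-refl       gr = gr
  go (≤′-step k≤l) gr = inj₁ (go k≤l gr)

-- Excluded middle and Borel maximal separated sets

module Classical (em : ExcludedMiddle 0ℓ) where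

  stable : {P : Set} → ¬ ¬ P → P
  stable = decidable-stable em

  ¬∀⇒∃¬ : {P : A → Set} → ¬ (∀ a → P a) → ∃ λ a → ¬ P a
  ¬∀⇒∃¬ ¬all = stable λ ¬ex → ¬all λ a → stable λ ¬p → ¬ex (a , ¬p)

  least : {P : ℕ → Set} → ∃ P → ∃ λ k → P k × (∀ j → j < k → ¬ P j)
  least {P} (k , p) = go k k ≤-refl p
    where
    go : ∀ b k → k ≤ b → P k → ∃ λ k → P k × (∀ j → j < k → ¬ P j)
    go b k k≤b p with em {∃ λ j → j < k × P j}
    ... | no  ¬smaller         = k , p , λ j j<k q → ¬smaller (j , j<k , q)
    go zero    k z≤n p | yes (j , () , q)
    go (suc b) k k≤b p | yes (j , j<k , q) = go b j (s≤s⁻¹ (≤-trans j<k k≤b)) q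

  -- If the top index occurs only finitely often, start after its last occurrence and use one index
  -- fewer.
  infinite-pigeonhole : {P : ℕ → ℕ → Set} (b : ℕ) → (∀ k → ∃ λ i → i < b × P k i) →
                        ∃ λ i → ∀ k₀ → ∃ λ k → k₀ ≤ k × P k i
  infinite-pigeonhole zero    p with p 0
  ... | _ , () , _
  infinite-pigeonhole {P} (suc b) p with em {∀ k₀ → ∃ λ k → k₀ ≤ k × P k b}
  ... | yes often = b , often
  ... | no ¬often with ¬∀⇒∃¬ ¬often
  ...   | k₀ , never with infinite-pigeonhole {λ k → P (k₀ + k)} b below
    where
    below : ∀ k → ∃ λ i → i < b × P (k₀ + k) i
    below k with p (k₀ + k)
    ... | i , s≤s i≤b , q with m≤n⇒m<n∨m≡n i≤b
    ...   | inj₁ i<b  = i , i<b , q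
    ...   | inj₂ refl = ⊥-elim (never (k₀ + k , m≤m+n k₀ k , q))
  ...     | i , often = i , λ k₁ →
    let k , k₁≤k , q = often k₁ in k₀ + k , ≤-trans k₁≤k (m≤n+m k k₀) , q

  ℬ-∀ : Countable I → {A : I → Pred (F n) 0ℓ} → (∀ i → ℬ (A i)) → ℬ (λ x → ∀ i → A i x)
  ℬ-∀ c b = resp
    ((λ none i → stable λ ¬a → none (i , ¬a)) , (λ all (i , ¬a) → ¬a (all i)))
    (complement (ℬ-∃ c (complement ∘ b)))

  ℬ-× : {A B : Pred (F n) 0ℓ} → ℬ A → ℬ B → ℬ (λ x → A x × B x)
  ℬ-× {A = A} {B} a b = resp
    ((λ all → all true , all false) , λ { (x∈A , x∈B) true → x∈A ; (x∈A , x∈B) false → x∈B })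
    (ℬ-∀ Bool-countable {λ c → if c then A else B} λ { true → a ; false → b })

  ℬ-if : {P : Pred (F n) 0ℓ} {A : Bool → Pred (F n) 0ℓ} → ℬ P → (∀ b → ℬ (A b)) →
         ℬ (λ x → A (does (em {P x})) x)
  ℬ-if {P = P} {A} p a = resp (to , from) (ℬ-⊎ (ℬ-× p (a true)) (ℬ-× (complement p) (a false)))
    where
    to : ∀ {x} → P x × A true x ⊎ ¬ P x × A false x → A (does (em {P x})) x
    to {x} (inj₁ (p , a))  = subst (λ b → A b x) (sym (dec-true em p)) a
    to {x} (inj₂ (¬p , a)) = subst (λ b → A b x) (sym (dec-false em ¬p)) a
    from : ∀ {x} → A (does (em {P x})) x → P x × A true x ⊎ ¬ P x × A false x
    from {x} a with em {P x}
    ... | yes p = inj₁ (p , a)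
    ... | no ¬p = inj₂ (¬p , a)

  ℬ-Near : ∀ r {A : Pred (F n) 0ℓ} → ℬ A → ℬ (Near r A)
  ℬ-Near r a = ℬ-∃ ℤ^-countable λ g → ℬ-× (ℬ-const _) (ℬ-shift g a)

  ℬ-Cylinder : (c : Code n) → ℬ (Cylinder c)
  ℬ-Cylinder []            = resp ((λ _ → []) , λ _ → tt) (ℬ-const ⊤)
  ℬ-Cylinder ((h , b) ∷ c) = resp
    ((λ (eq , eqs) → eq ∷ eqs) , λ { (eq ∷ eqs) → eq , eqs })
    (ℬ-× (open-set ((λ x → x h ≡ b) , lift (λ x eq → h ∷ [] , λ { y (eq′ ∷ []) → trans eq′ eq }) , id , id))
         (ℬ-Cylinder c))

  ℬ-SeparatedCylinder : ∀ r (c : Code n) → ℬ (SeparatedCylinder r c)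
  ℬ-SeparatedCylinder r c = ℬ-× (ℬ-Cylinder c)
    (ℬ-∀ ℤ^-countable λ g → complement (ℬ-× (ℬ-const _) (ℬ-× (ℬ-const _) (ℬ-shift g (ℬ-Cylinder c)))))

  ℬ-greedy : ∀ r {Y : Pred (F n) 0ℓ} → ℬ Y → ∀ k → ℬ (greedy r Y k)
  ℬ-greedy r y zero    = ℬ-const ⊥
  ℬ-greedy r y (suc k) = ℬ-⊎ (ℬ-greedy r y k)
    (ℬ-× y (ℬ-× (ℬ-SeparatedCylinder r _) (complement (ℬ-Near r (ℬ-greedy r y k)))))

  ℬ-Maximal : ∀ r {Y : Pred (F n) 0ℓ} → ℬ Y → ℬ (Maximal r Y)
  ℬ-Maximal r y = ℬ-∃ ℕ-countable (ℬ-greedy r y)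

  -- By freeness, each of the finitely many short translates of x differs from
  -- x at some coordinate; the code collects these coordinates.
  separatedCylinders-cover : ∀ r (x : F n) → ∃ λ c → SeparatedCylinder r c x
  separatedCylinders-cover {n} r x@(ξ , free) = code gs , code-∋x gs , λ g (short , g≢𝟎 , gx∈) →
    code-separates gs g≢𝟎 (complete g short) gx∈
    where
    gs : List (ℤ^ n)
    gs = proj₁ (‖‖≤-list r)
    complete : ∀ g → ‖ g ‖ ≤ r → g ∈ˡ gs
    complete = proj₂ (‖‖≤-list r)
    moved : ∀ g → g ≢ 𝟎 → ∃ λ h → ξ (g ⊕ h) ≢ ξ h
    moved g g≢𝟎 = ¬∀⇒∃¬ (free g g≢𝟎)
    code : List (ℤ^ n) → Code n
    code []       = []
    code (g ∷ gs) with em {g ≡ 𝟎}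
    ... | yes _  = code gs
    ... | no g≢𝟎 = let h , _ = moved g g≢𝟎 in (h , ξ h) ∷ code gs
    code-∋x : ∀ gs → Cylinder (code gs) x
    code-∋x []       = []
    code-∋x (g ∷ gs) with em {g ≡ 𝟎}
    ... | yes _  = code-∋x gs
    ... | no g≢𝟎 = refl ∷ code-∋x gs
    code-separates : ∀ gs {g} → g ≢ 𝟎 → g ∈ˡ gs → ¬ Cylinder (code gs) (g · x)
    code-separates (g ∷ gs) g≢𝟎 g∈gs gx∈ with em {g ≡ 𝟎}
    code-separates (g ∷ gs) g≢𝟎 (here refl) gx∈ | yes g≡𝟎 = g≢𝟎 g≡𝟎
    code-separates (g ∷ gs) g≢𝟎 (there g∈)  gx∈ | yes _   = code-separates gs g≢𝟎 g∈ gx∈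
    code-separates (g ∷ gs) g≢𝟎 (here refl) (eq ∷ gx∈) | no g≢𝟎′ = proj₂ (moved g g≢𝟎′) eq
    code-separates (g ∷ gs) g≢𝟎 (there g∈)  (eq ∷ gx∈) | no _ = code-separates gs g≢𝟎 g∈ gx∈

  module _ (r : ℕ) {Y : Pred (F n) 0ℓ} (Y-borel : ℬ Y) where

    -- Points of different stages are kept apart by the `Near` condition, points of the same stage
    -- by their common separated cylinder.
    greedy-separated : ∀ k → Separated r (greedy r Y k)
    greedy-separated (suc k) x g (inj₁ xold) (inj₁ gxold) short = greedy-separated k x g xold gxold short
    greedy-separated (suc k) x g (inj₁ xold) (inj₂ (_ , _ , ¬near)) short = ⊥-elim (¬near
      ( neg g , ≤-trans (≤-reflexive (‖neg‖ g)) short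
      , ℬ-resp-≈ (ℬ-greedy r Y-borel k) x (neg g · g · x) back xold))
      where
      back : x ≈ neg g · g · x
      back h = cong (proj₁ x) (sym (⊕-neg-cancel g h))
    greedy-separated (suc k) x g (inj₂ (_ , _ , ¬near)) (inj₁ gxold) short = ⊥-elim (¬near (g , short , gxold))
    greedy-separated (suc k) x g (inj₂ (_ , (_ , sep) , _)) (inj₂ (_ , (gx∈ , _) , _)) short =
      stable λ g≢𝟎 → sep g (short , g≢𝟎 , gx∈)

    maximal-separated : Separated r (Maximal r Y)
    maximal-separated x g (k , xk) (l , gxl) = greedy-separated (k ⊔ l) x g
      (greedy-mono r (m≤m⊔n k l) xk) (greedy-mono r (m≤n⊔m k l) gxl)

    -- A point with nothing chosen nearby when its own separated cylinder has its turn is itself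
    -- chosen then.
    maximal-near : Y ⊆ Near r (Maximal r Y)
    maximal-near {x} x∈Y with separatedCylinders-cover r x
    ... | c , x∈c with index Code-countable c
    ...   | k , refl with em {Near r (greedy r Y k) x}
    ...     | yes (g , short , gx∈) = g , short , k , gx∈
    ...     | no ¬near = 𝟎 , ≤-trans (≤-reflexive (dist-refl (𝟎 {n}))) z≤n ,
      ℬ-resp-≈ (ℬ-Maximal r Y-borel) x (𝟎 · x) (sym ∘ ·-𝟎 x) (suc k , inj₂ (x∈Y , x∈c , ¬near))

  -- Centers

  -- One set separated by `5 * L` cannot be expected to come within `L` of every point; each further
  -- layer serves the points that the earlier ones missed.
  rest layer : ℕ → ℕ → Pred (F n) 0ℓ
  rest  L zero    x = ⊤
  rest  L (suc i) x = rest L i x × ¬ Near L (layer L i) x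
  layer L i         = Maximal (5 * L) (rest L i)

  ℬ-rest : ∀ L i → ℬ (rest {n} L i)
  ℬ-rest L zero    = ℬ-const ⊤
  ℬ-rest L (suc i) = ℬ-× (ℬ-rest L i) (complement (ℬ-Near L (ℬ-Maximal (5 * L) (ℬ-rest L i))))

  ℬ-layer : ∀ L i → ℬ (layer {n} L i)
  ℬ-layer L i = ℬ-Maximal (5 * L) (ℬ-rest L i)

  rest-antitone : ∀ L {i j} → i ≤ j → rest {n} L j ⊆ rest L i
  rest-antitone L i≤j x∈ = go (≤⇒≤′ i≤j) x∈
    where
    go : ∀ {i j} → i ≤′ j → rest {n} L j ⊆ rest L i
    go ≤′-refl       x∈       = x∈
    go (≤′-step i≤j) (x∈ , _) = go i≤j x∈

  layers-separated : ∀ L {i j} (x : F n) g h → i < j → layer L i (g · x) → layer L j (h · x) → ¬ dist g h ≤ L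
  layers-separated L {i} x g h i<j gx∈ hx∈ close =
    proj₂ (rest-antitone L i<j (maximal-⊆ (5 * L) hx∈))
      ( neg h ⊕ g , ≤-trans (≤-reflexive (‖neg⊕‖ h g)) close
      , ℬ-resp-≈ (ℬ-layer L i) (g · x) ((neg h ⊕ g) · h · x)
          (λ k → cong (proj₁ x) (trans (cong (_⊕ k) (sym (⊕-neg-cancel h g))) (⊕-assoc h (neg h ⊕ g) k))) gx∈)

  -- Otherwise each of the first `10 ^ n + 1` layers has a center within `5 * L` of `x`. Two of
  -- these share a cell and so lie within `L`, but different layers are further apart than that.
  rest-exhausted : ∀ L (x : F n) → ¬ rest L (10 ^ n) x
  rest-exhausted {n} L x x∈ =
    let i , j , i<j , same-cell = Fin.pigeonhole (n<1+n (10 ^ n)) (λ i → cell L (center i) (short i))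
    in layers-separated L x (center i) (center j) i<j (proj₂ (proj₂ (near i))) (proj₂ (proj₂ (near j)))
         (cell-close L (center i) (center j) (short i) (short j) same-cell)
    where
    near : (i : Fin (suc (10 ^ n))) → Near (5 * L) (layer L (toℕ i)) x
    near i = maximal-near (5 * L) (ℬ-rest L (toℕ i)) (rest-antitone L (s≤s⁻¹ (Fin.toℕ<n i)) x∈)
    center : (i : Fin (suc (10 ^ n))) → ℤ^ n
    center i = proj₁ (near i)
    short : (i : Fin (suc (10 ^ n))) → ‖ center i ‖ ≤ 5 * L
    short i = proj₁ (proj₂ (near i))

  layers-cover : ∀ L (x : F n) → ∃ λ i → i < 10 ^ n × Near L (layer L i) x
  layers-cover {n} L x = go (10 ^ n) (rest-exhausted L x)
    where
    go : ∀ b → ¬ rest L b x → ∃ λ i → i < b × Near L (layer L i) x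
    go zero    exhausted = ⊥-elim (exhausted tt)
    go (suc b) exhausted with em {rest L b x}
    ... | yes x∈ = b , n<1+n b , stable λ ¬near → exhausted (x∈ , ¬near)
    ... | no x∉  = let i , i<b , near = go b x∉ in i , m<n⇒m<1+n i<b , near

  near-shift : ∀ {r} {A : Pred (F n) 0ℓ} → ℬ A → ∀ g x → Near r A x → Near (‖ g ‖ + r) A (g · x)
  near-shift A-borel g x (h , short , hx∈) = neg g ⊕ h ,
    ≤-trans (‖⊕‖ (neg g) h) (+-mono-≤ (≤-reflexive (‖neg‖ g)) short) ,
    ℬ-resp-≈ A-borel (h · x) ((neg g ⊕ h) · g · x)
      (λ k → cong (proj₁ x) (trans (cong (_⊕ k) (sym (⊕-neg-cancel g h))) (⊕-assoc g (neg g ⊕ h) k))) hx∈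

  unshift : {A : Pred (F n) 0ℓ} → ℬ A → ∀ g x → A (neg g · g · x) → A x
  unshift A-borel g x = ℬ-resp-≈ A-borel (neg g · g · x) x λ k → cong (proj₁ x) (⊕-neg-cancel g k)

  -- The additive constant s makes recurrence invariant under the action.
  Recurrent : ℕ → Pred (F n) 0ℓ
  Recurrent i x = ∃ λ s → ∀ k₀ → ∃ λ k → k₀ ≤ k × Near (s + mesh k) (layer (mesh k) i) x

  ℬ-Recurrent : ∀ i → ℬ (Recurrent {n} i)
  ℬ-Recurrent i = ℬ-∃ ℕ-countable λ s → ℬ-∀ ℕ-countable λ k₀ → ℬ-∃ ℕ-countable λ k →
    ℬ-× (ℬ-const _) (ℬ-Near _ (ℬ-layer (mesh k) i))

  recurrent-shift : ∀ i g (x : F n) → Recurrent i x → Recurrent i (g · x)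
  recurrent-shift i g x (s , often) = ‖ g ‖ + s , λ k₀ →
    let k , k₀≤k , near = often k₀
    in k , k₀≤k , subst (λ r → Near r (layer (mesh k) i) (g · x)) (sym (+-assoc ‖ g ‖ s (mesh k)))
                        (near-shift (ℬ-layer (mesh k) i) g x near)

  recurrent-unshift : ∀ i g (x : F n) → Recurrent i (g · x) → Recurrent i x
  recurrent-unshift i g x rec = unshift (ℬ-Recurrent i) g x (recurrent-shift i (neg g) (g · x) rec)

  LeastRecurrent : ℕ → Pred (F n) 0ℓ
  LeastRecurrent i x = Recurrent i x × (∀ j → ¬ (j < i × Recurrent j x))

  ℬ-LeastRecurrent : ∀ i → ℬ (LeastRecurrent {n} i)
  ℬ-LeastRecurrent i = ℬ-× (ℬ-Recurrent i)
    (ℬ-∀ ℕ-countable λ j → complement (ℬ-× (ℬ-const _) (ℬ-Recurrent j)))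

  -- The number of layers does not depend on the scale, so one index serves infinitely many scales,
  -- with additive constant 0.
  recurrent-exists : ∀ (x : F n) → ∃ λ i → Recurrent i x
  recurrent-exists {n} x =
    map₂ (λ often → 0 , often)
      (infinite-pigeonhole {λ k i → Near (mesh k) (layer (mesh k) i) x} (10 ^ n) λ k → layers-cover (mesh k) x)

  leastRecurrent-exists : ∀ (x : F n) → ∃ λ i → LeastRecurrent i x
  leastRecurrent-exists x =
    map₂ (map₂ λ first j (j<i , rec) → first j j<i rec)
      (least {λ i → Recurrent i x} (recurrent-exists x))

  -- The least recurrent index is constant on orbits, so each orbit uses a single layer per scale
  -- and keeps its separation.
  Center : ℕ → Pred (F n) 0ℓ
  Center k x = ∃ λ i → LeastRecurrent i x × layer (mesh k) i x

  ℬ-Center : ∀ k → ℬ (Center {n} k)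
  ℬ-Center k = ℬ-∃ ℕ-countable λ i → ℬ-× (ℬ-LeastRecurrent i) (ℬ-layer (mesh k) i)

  leastRecurrent-unique : ∀ {i j} g (x : F n) → LeastRecurrent i x → LeastRecurrent j (g · x) → i ≡ j
  leastRecurrent-unique {i = i} {j} g x (rec , first) (rec′ , first′) with <-cmp i j
  ... | tri< i<j _ _ = ⊥-elim (first′ i (i<j , recurrent-shift i g x rec))
  ... | tri≈ _ i≡j _ = i≡j
  ... | tri> _ _ j<i = ⊥-elim (first j (j<i , recurrent-unshift j g x rec′))

  leastRecurrent-shift : ∀ {i} g (x : F n) → LeastRecurrent i x → LeastRecurrent i (g · x)
  leastRecurrent-shift {i = i} g x (rec , first) =
    recurrent-shift i g x rec , λ j (j<i , rec′) → first j (j<i , recurrent-unshift j g x rec′)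

  centers-separated : ∀ k → Separated (5 * mesh k) (Center {n} k)
  centers-separated k x g (i , lr , x∈) (j , lr′ , gx∈) short with leastRecurrent-unique g x lr lr′
  ... | refl = maximal-separated (5 * mesh k) (ℬ-rest (mesh k) i) x g x∈ gx∈ short

  centers-cover : ∀ (x : F n) → ∃ λ k → Near (cover k) (Center k) x
  centers-cover x =
    let i , lr             = leastRecurrent-exists x
        (s , often) , _     = lr
        -- Asking for a scale `k` beyond `s` makes `s + mesh k` at most `cover k`.
        k , s≤k , g , short , gx∈ = often s
    in k , g , ≤-trans short (≤-trans (+-monoˡ-≤ (mesh k) s≤k) (≤-reflexive (+-comm k (mesh k)))) ,
       i , leastRecurrent-shift g x lr , gx∈

  -- The centers on the orbit of `x`, in coordinates with `x` at the origin.
  centers : F n → Centers n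
  centers x k g = Center k (g · x)

  orbit-separated : ∀ (x : F n) k m m′ → centers x k m → centers x k m′ → dist m m′ ≤ 5 * mesh k → m ≡ m′
  orbit-separated x k m m′ m∈ m′∈ close =
    trans (sym (⊕-neg-cancel m′ m)) (trans (cong (m′ ⊕_) neg⊕≡𝟎) (⊕-identityʳ m′))
    where
    neg⊕≡𝟎 : neg m′ ⊕ m ≡ 𝟎
    neg⊕≡𝟎 = centers-separated k (m′ · x) (neg m′ ⊕ m) m′∈
      (ℬ-resp-≈ (ℬ-Center k) (m · x) ((neg m′ ⊕ m) · m′ · x)
        (λ h → cong (proj₁ x) (trans (cong (_⊕ h) (sym (⊕-neg-cancel m′ m))) (⊕-assoc m′ (neg m′ ⊕ m) h))) m∈)
      (≤-trans (≤-reflexive (‖neg⊕‖ m′ m)) close)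

  orbit-covered : ∀ (x : F n) g → ∃ λ k → ∃ λ m → Piece (centers x) k m g
  orbit-covered x g =
    let k , h , short , center = centers-cover (g · x)
    in k , g ⊕ h
     , ℬ-resp-≈ (ℬ-Center k) (h · g · x) ((g ⊕ h) · x) (sym ∘ ·-⊕ g h x) center
     , hull-⊇ (centers x) k {Ball (cover k) (g ⊕ h)}
         (subst (_≤ cover k) (sym (trans (cong (λ m → dist m g) (⊕-comm g h)) (dist-⊕ h g))) short)

  orbit-homes : ∀ (x : F n) g → ∃ λ k → ∃ λ m → Home (centers x) k m g
  orbit-homes x g =
    let k , (m , piece) , first = least {λ k → ∃ λ m → Piece (centers x) k m g} (orbit-covered x g)
    in k , m , piece , λ j (j<k , covered) → first j j<k covered

  -- The colouring

  shade : Centers n → ℤ^ n → Fin 3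
  shade N g = palette (does (em {Odd N g})) (does (em {Clash N 2 g})) (does (em {Clash N 1 g}))

  shade-correct : ∀ (N : Centers n) g → Shade N g (shade N g)
  shade-correct N g with em {Odd N g} | em {Clash N 2 g} | em {Clash N 1 g}
  ... | yes o | yes c | _      = odd-clash o c
  ... | yes o | no ¬c | _      = odd-no-clash o ¬c
  ... | no ¬o | _     | yes c  = even-clash ¬o c
  ... | no ¬o | _     | no ¬c  = even-no-clash ¬o ¬c

  colouring : F n → Fin 3
  colouring x = shade (centers x) 𝟎

  module _ (N : F n → Centers n) (N-borel : ∀ k g → ℬ (λ x → N x k g)) where

    ℬ-absorb : ∀ k {Q : F n → Pred (ℤ^ n) 0ℓ} → (∀ g → ℬ (λ x → Q x g)) →
               ∀ g → ℬ (λ x → absorb (N x) k (Q x) g)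
    ℬ-absorb k q g = ℬ-⊎ (q g) (ℬ-∃ ℤ^-countable λ m → ℬ-× (N-borel k m)
      (ℬ-× (ℬ-∃ ℤ^-countable λ h → ℬ-× (q h) (ℬ-const _)) (ℬ-const _)))

    ℬ-hull : ∀ k {Q : F n → Pred (ℤ^ n) 0ℓ} → (∀ g → ℬ (λ x → Q x g)) →
             ∀ g → ℬ (λ x → hull (N x) k (Q x) g)
    ℬ-hull zero    q g = q g
    ℬ-hull (suc k) q g = ℬ-hull k (ℬ-absorb k q) g

    ℬ-Piece : ∀ k m g → ℬ (λ x → Piece (N x) k m g)
    ℬ-Piece k m g = ℬ-× (N-borel k m) (ℬ-hull k (λ _ → ℬ-const _) g)

    ℬ-Home : ∀ k m g → ℬ (λ x → Home (N x) k m g)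
    ℬ-Home k m g = ℬ-× (ℬ-Piece k m g)
      (ℬ-∀ ℕ-countable λ j → complement (ℬ-× (ℬ-const _) (ℬ-∃ ℤ^-countable λ m′ → ℬ-Piece j m′ g)))

    ℬ-Odd : ∀ g → ℬ (λ x → Odd (N x) g)
    ℬ-Odd g = ℬ-∃ ℕ-countable λ k → ℬ-∃ ℤ^-countable λ m → ℬ-× (ℬ-Home k m g) (ℬ-const _)

    ℬ-Clash : ∀ r g → ℬ (λ x → Clash (N x) r g)
    ℬ-Clash r g = ℬ-∃ ℕ-countable λ k → ℬ-∃ ℤ^-countable λ m → ℬ-× (ℬ-Home k m g)
      (ℬ-∃ ℕ-countable λ j → ℬ-∃ ℤ^-countable λ m′ → ℬ-∃ ℤ^-countable λ h →
        ℬ-× (ℬ-const _) (ℬ-× (ℬ-Piece j m′ h) (ℬ-const _)))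

    ℬ-shade : (A : Pred (Fin 3) 0ℓ) → ∀ g → ℬ (λ x → A (shade (N x) g))
    ℬ-shade A g =
      ℬ-if {A = λ o x → A (palette o (does (em {Clash (N x) 2 g})) (does (em {Clash (N x) 1 g})))} (ℬ-Odd g) λ o →
      ℬ-if {A = λ c x → A (palette o c (does (em {Clash (N x) 1 g})))} (ℬ-Clash 2 g) λ c₂ →
      ℬ-if {A = λ c x → A (palette o c₂ c)} (ℬ-Clash 1 g) λ c₁ → ℬ-const _

  colouring-borel : BorelMap (FOpen {n}) DiscreteOpen colouring
  colouring-borel {A = A} _ = ℬ-shade centers (λ k g → ℬ-shift g (ℬ-Center k)) A 𝟎

  -- Both endpoints see the same toast in coordinates that differ by `s`, so the colour of `y` is
  -- the shade at `s ⊕ 𝟎` on the orbit of `x`, next to the shade of `x` at `𝟎`.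
  colouring-proper : ∀ {x y : F n} → Schreier x y → colouring x ≢ colouring y
  colouring-proper {x = x} {y} (s , gen , y≈s·x) =
    Shades.shades-differ (centers x) (orbit-separated x) (orbit-homes x)
      (dist-swap (s ⊕ 𝟎) 𝟎 (subst (_≤ 1) (sym (dist-⊕ s 𝟎)) (generator-short gen)))
      (generator-flips gen 𝟎)
      (shade-correct (centers x) 𝟎)
      (shade-shift {N = centers y} {N′ = centers x} s (generator-flips gen) to from (shade-correct (centers y) 𝟎))
    where
    to : ∀ k m → centers y k m → centers x k (s ⊕ m)
    to k m = ℬ-resp-≈ (ℬ-Center k) (m · y) ((s ⊕ m) · x)
      λ h → trans (y≈s·x (m ⊕ h)) (cong (proj₁ x) (sym (⊕-assoc s m h)))
    from : ∀ k m → centers x k m → centers y k (neg s ⊕ m)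
    from k m = ℬ-resp-≈ (ℬ-Center k) (m · x) ((neg s ⊕ m) · y)
      λ h → sym (trans (y≈s·x ((neg s ⊕ m) ⊕ h))
        (cong (proj₁ x) (trans (sym (⊕-assoc s (neg s ⊕ m) h)) (cong (_⊕ h) (⊕-neg-cancel s m)))))

  upper-bound : BorelColoring (FOpen {n}) Schreier (fin 3)
  upper-bound = colouring , (λ {A} → colouring-borel {A = A}) , λ {x} {y} → colouring-proper {x = x} {y}

  -- Borel sets are clopen relative to a comeager set

  Local : Pred (Config n) 0ℓ → Pred (F n) 0ℓ → ℕ → Config n → Set
  Local {n} G A r x = ∀ (y : F n) → G (proj₁ y) → Agree r x (proj₁ y) → A y

  -- A form of the Baire property that is symmetric under complement; only open sets and countable
  -- unions require `G` to shrink.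
  ClopenOn : Pred (Config n) 0ℓ → Pred (F n) 0ℓ → Set
  ClopenOn {n} G A = ∀ (x : F n) → G (proj₁ x) → ∃ λ r → Local G A r (proj₁ x) ⊎ Local G (∁ A) r (proj₁ x)

  -- Being decided by some cylinder is an open condition. It is dense: a cylinder in which `A` meets
  -- `G` contains a point decided for `A`, and any other cylinder is already decided against `A`.
  relatively-open⇒clopen : ∀ {G} {A : Pred (F n) 0ℓ} → Comeager G →
    (∀ x → G (proj₁ x) → A x → ∃ λ r → Local G A r (proj₁ x)) → Σ (Pred (Config n) 0ℓ) λ H → Comeager H × ClopenOn H A
  relatively-open⇒clopen {n} {G} {A} G-comeager A-open =
    (λ x → G x × Decided x) , comeager-∩ G-comeager (comeager-open-dense decided-open decided-dense) ,
    λ x (_ , r , decided) → r , Sum.map (λ l y y∈ → l y (proj₁ y∈)) (λ l y y∈ → l y (proj₁ y∈)) decided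
    where
    Decided : Pred (Config n) 0ℓ
    Decided x = ∃ λ r → Local G A r x ⊎ Local G (∁ A) r x
    decided-open : IsOpen Decided
    decided-open x (r , decided) = r , λ y xy → r , Sum.map
      (λ l z z∈ yz → l z z∈ (agree-trans xy yz)) (λ l z z∈ yz → l z z∈ (agree-trans xy yz)) decided
    decided-dense : Dense Decided
    decided-dense x r with em {∃ λ (y : F n) → G (proj₁ y) × Agree r x (proj₁ y) × A y}
    ... | yes (y , y∈G , xy , y∈A) = proj₁ y , xy , map₂ inj₁ (A-open y y∈G y∈A)
    ... | no none = x , (λ _ _ → refl) , r , inj₂ λ y y∈G xy y∈A → none (y , y∈G , xy , y∈A)

  generically-clopen : {A : Pred (F n) 0ℓ} → ℬ A → Σ (Pred (Config n) 0ℓ) λ G → Comeager G × ClopenOn G A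
  generically-clopen (open-set (U , lift isOpen , A⊆U , U⊆A)) = relatively-open⇒clopen
    (comeager-open-dense {U = λ _ → ⊤} (λ _ _ → 0 , λ _ _ → tt) (λ x r → x , (λ _ _ → refl) , tt))
    λ x _ x∈A →
      let hs , cylinder = isOpen (proj₁ x) (A⊆U x∈A)
          r , agree     = agree-list hs
      in r , λ y _ xy → U⊆A (cylinder (proj₁ y) (agree xy))
  generically-clopen (complement b) =
    map₂ (map₂ λ clopen x x∈ → map₂ [ (λ l → inj₂ λ y y∈ xy y∉A → y∉A (l y y∈ xy)) , inj₁ ]′ (clopen x x∈))
      (generically-clopen b)
  generically-clopen {n} (union {A} bs) = relatively-open⇒clopen (comeager-⋂ ℕ-countable (λ k → proj₁ (proj₂ (ih k)))) open-union
    where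
    ih : ∀ k → Σ (Pred (Config n) 0ℓ) λ G → Comeager G × ClopenOn G (A k)
    ih k = generically-clopen (bs k)
    open-union : ∀ (x : F n) → (∀ k → proj₁ (ih k) (proj₁ x)) → ⋃ ℕ A x →
                 ∃ λ r → Local (λ x → ∀ k → proj₁ (ih k) x) (⋃ ℕ A) r (proj₁ x)
    open-union x x∈G (k , x∈A) with proj₂ (proj₂ (ih k)) x (x∈G k)
    ... | r , inj₁ l = r , λ y y∈G xy → k , l y (y∈G k) xy
    ... | r , inj₂ l = ⊥-elim (l x (x∈G k) (λ _ _ → refl) x∈A)
  generically-clopen (resp (A⊆B , B⊆A) b) =
    map₂ (map₂ λ clopen x x∈ → map₂ (Sum.map (λ l y y∈ xy → A⊆B (l y y∈ xy)) (λ l y y∈ xy → l y y∈ xy ∘ B⊆A)) (clopen x x∈))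
      (generically-clopen b)

  -- The translate of a pattern of radius r by the odd vector far (r + r) is
  -- disjoint from it, so some generic point shows the pattern at both places.
  repeated-pattern : {G : Pred (Config (suc n)) 0ℓ} → Comeager G → ∀ r (x : Config (suc n)) → ∃ λ (y : F (suc n)) →
    G (proj₁ y) × Agree r x (proj₁ y) × G (far (r + r) ∙ proj₁ y) × Agree r x (far (r + r) ∙ proj₁ y)
  repeated-pattern {n} {G} G-comeager r x =
    -- A ball of radius `‖ t ‖ + r` contains both copies of the pattern.
    let y , agree , (y∈G , ty∈G) , free = baire generic y₀ (‖ t ‖ + r)
    in (y , free) , y∈G ,
       (λ h short → trans (sym (y₀-inside short)) (agree h (≤-trans short (m≤n+m r ‖ t ‖)))) ,
       ty∈G ,
       (λ h short → trans (trans (cong x (sym (neg-⊕-cancel t h))) (sym (y₀-outside (far-outside h short))))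
         (agree (t ⊕ h) (shift-short t h short)))
    where
    t : ℤ^ (suc n)
    t = far (r + r)
    generic : Comeager (λ x → (G x × G (t ∙ x)) × Free x)
    generic = comeager-∩ (comeager-∩ G-comeager (comeager-shift t G-comeager)) free-comeager
    y₀ : Config (suc n)
    y₀ h = if does (‖ h ‖ ≤? r) then x h else x (neg t ⊕ h)
    y₀-inside : ∀ {h} → ‖ h ‖ ≤ r → y₀ h ≡ x h
    y₀-inside {h} short = cong (λ b → if b then x h else x (neg t ⊕ h)) (dec-true (‖ h ‖ ≤? r) short)
    y₀-outside : ∀ {h} → ¬ ‖ h ‖ ≤ r → y₀ h ≡ x (neg t ⊕ h)
    y₀-outside {h} long = cong (λ b → if b then x h else x (neg t ⊕ h)) (dec-false (‖ h ‖ ≤? r) long)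
    far-outside : ∀ h → ‖ h ‖ ≤ r → ¬ ‖ t ⊕ h ‖ ≤ r
    far-outside h short th-short = <⇒≱ (far-far {n} (r + r))
      (subst (_≤ r + r) (dist-⊕ t h) (dist-step (t ⊕ h) 𝟎 h th-short (dist-swap h 𝟎 short)))

  -- Alternation along the first generator and the lower bound

  step : ℕ → ℤ^ (suc n)
  step k = + k ∷ 𝟎

  step-suc : ∀ k (x : F (suc n)) → step k · e Fin.zero · x ≈ step (suc k) · x
  step-suc k x h = cong (proj₁ x) (trans (sym (⊕-assoc (e Fin.zero) (step k) h))
    (cong (λ g → ((+ suc k) ∷ g) ⊕ h) (⊕-identityˡ 𝟎)))

  walk : ∀ k {P Q : Pred (F (suc n)) 0ℓ} → ℬ P → ℬ Q →
         (∀ x → P x → Q (e Fin.zero · x)) → (∀ x → Q x → P (e Fin.zero · x)) →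
         ∀ x → P x → (if odd k then Q else P) (step k · x)
  walk zero    P-borel _ _ _ x x∈P = ℬ-resp-≈ P-borel x (𝟎 · x) (sym ∘ ·-𝟎 x) x∈P
  -- After the first step the roles of `P` and `Q` are exchanged for the remaining `k` steps.
  walk (suc k) P-borel Q-borel p⇒q q⇒p x x∈P with odd k | walk k Q-borel P-borel q⇒p p⇒q (e Fin.zero · x) (p⇒q x x∈P)
  ... | true  | w = ℬ-resp-≈ P-borel _ (step (suc k) · x) (step-suc k x) w
  ... | false | w = ℬ-resp-≈ Q-borel _ (step (suc k) · x) (step-suc k x) w

  odd-suc-double : ∀ r → odd (suc (r + r)) ≡ true
  odd-suc-double zero    = refl
  odd-suc-double (suc r) rewrite +-suc r r = trans (not-involutive _) (odd-suc-double r)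

  walk-far : ∀ r {P Q : Pred (F (suc n)) 0ℓ} → ℬ P → ℬ Q →
             (∀ x → P x → Q (e Fin.zero · x)) → (∀ x → Q x → P (e Fin.zero · x)) →
             ∀ x → P x → Q (far (r + r) · x)
  walk-far r {P} {Q} P-borel Q-borel p⇒q q⇒p x x∈P =
    subst (λ b → (if b then Q else P) (far (r + r) · x)) (odd-suc-double r)
      (walk (suc (r + r)) P-borel Q-borel p⇒q q⇒p x x∈P)

  Alternates : Pred (F (suc n)) 0ℓ → Set
  Alternates A = (∀ x → A x → ¬ A (e Fin.zero · x)) × (∀ x → ¬ A x → A (e Fin.zero · x))

  -- A generic point with the pattern both at the origin and at an odd distance along the first axis
  -- would lie on the same side of `A` at both places, while alternation puts it on opposite sides.
  undecided : ∀ {G} {A : Pred (F (suc n)) 0ℓ} → Comeager G → ℬ A → Alternates A →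
              ∀ r x → ¬ (Local G A r x ⊎ Local G (∁ A) r x)
  undecided G-comeager A-borel (leaves , enters) r x decided =
    let y , y∈G , xy , ty∈G , xty = repeated-pattern G-comeager r x
    in [ (λ l → walk-far r A-borel (complement A-borel) leaves enters y (l y y∈G xy) (l (far (r + r) · y) ty∈G xty))
       , (λ l → l (far (r + r) · y) ty∈G xty (walk-far r (complement A-borel) A-borel enters leaves y (l y y∈G xy)))
       ]′ decided

  no-alternating-set : {A : Pred (F (suc n)) 0ℓ} → ℬ A → ¬ Alternates A
  no-alternating-set A-borel alternates =
    let G , G-comeager , clopen = generically-clopen A-borel
        -- Only some free point of `G` is wanted here; the radius and the pattern are arbitrary.
        x , x∈G , _             = repeated-pattern G-comeager 0 (λ _ → false)
        r , decided             = clopen x x∈G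
    in undecided G-comeager A-borel alternates r (proj₁ x) decided

  -- With at most two colours, all points outside colour class 0 share one colour, so properness
  -- makes class 0 alternate.
  no-2-colouring : ∀ {m} → m ≤ 2 → ¬ BorelColoring (FOpen {suc n}) Schreier (fin m)
  no-2-colouring {n} m≤2 (c , c-borel , c-proper) = no-alternating-set {A = Zero} (c-borel {λ i → toℕ i ≡ 0} (open-set _))
    ((λ x x∈A sx∈A → moved x (trans x∈A (sym sx∈A))) ,
     (λ x x∉A → stable λ sx∉A → moved x (trans (one x x∉A) (sym (one (e Fin.zero · x) sx∉A)))))
    where
    Zero : Pred (F (suc n)) 0ℓ
    Zero x = toℕ (c x) ≡ 0
    moved : ∀ x → toℕ (c x) ≢ toℕ (c (e Fin.zero · x))
    moved x eq = c-proper (e Fin.zero , (Fin.zero , inj₁ refl) , λ _ → refl) (Fin.toℕ-injective eq)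
    one : ∀ x → ¬ Zero x → toℕ (c x) ≡ 1
    one x x∉A with toℕ (c x) | ≤-trans (Fin.toℕ<n (c x)) m≤2
    ... | zero        | _               = ⊥-elim (x∉A refl)
    ... | suc zero    | _               = refl
    ... | suc (suc _) | s≤s (s≤s ())

  lower-bound : ∀ κ → BorelColoring (FOpen {suc n}) Schreier κ → fin 3 ≤ᶜ κ
  lower-bound ℵ₀      _ = mk↣ {to = toℕ} Fin.toℕ-injective
  lower-bound (fin m) c with 3 ≤? m
  ... | yes 3≤m = mk↣ {to = λ i → Fin.inject≤ i 3≤m} (Fin.inject≤-injective 3≤m 3≤m _ _)
  ... | no 3≰m  = ⊥-elim (no-2-colouring (s≤s⁻¹ (≰⇒> 3≰m)) c)

corollary4p10 : ExcludedMiddle 0ℓ → (n : ℕ) → n ≥ 1 → IsBorelChromaticNumber (FOpen {n}) (Schreier {n}) (fin 3)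
corollary4p10 em (suc n) _ = upper-bound , lower-bound
  where open Classical em
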